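{- Let $n\ge 3$ be an integer whose smallest prime divisor is at least $7$. Then $\operatorname{ext}_D(C_n)=4$.
   Context: $C_n$ is the cycle on $n$ vertices, with automorphism group the dihedral group acting on $V(C_n)$. A vertex coloring is distinguishing if the only automorphism preserving all colors is the identity; $D(C_n)$ is the least number of colors admitting a distinguishing coloring (it equals $2$ for $n\ge 6$). A set $S\subseteq V(C_n)$ is a fixing set if every non-identity automorphism moves some element of $S$. $\operatorname{ext}_D(C_n)$ is the minimum $m$ such that for every fixing set $W\subseteq V(C_n)$ with $|W|\ge m$, every coloring $V(C_n)\setminus W\to\{1,\dots,D(C_n)\}$ extends to a distinguishing $D(C_n)$-coloring of $V(C_n)$. -}

module Defs where

open import Data.Nat using (ℕ; _+_; _∸_; _≤_; _<_; NonZero)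
open import Data.Nat.DivMod using (_mod_)
open import Data.Fin using (Fin; toℕ)
open import Data.Fin.Subset using (Subset; _∈_; _∉_; ∣_∣)
open import Data.Product using (Σ; ∃; _×_)
open import Relation.Binary.PropositionalEquality using (_≡_; _≢_)
open import Relation.Nullary using (¬_)

-- Vertices of C_n are Fin n = {0,…,n-1}; vertex i is adjacent to i ± 1 (mod n).
-- Its automorphism group is the dihedral group D_n, whose elements are
-- the rotations  i ↦ i + a (mod n)  and the reflections  i ↦ a - i (mod n).
data Aut (n : ℕ) : Set where
  rot : Fin n → Aut n
  ref : Fin n → Aut n

act : ∀ {n} .{{_ : NonZero n}} → Aut n → Fin n → Fin n
act {n} (rot a) i = (toℕ i + toℕ a) mod n
act {n} (ref a) i = (toℕ a + (n ∸ toℕ i)) mod n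

IsIdentity : ∀ {n} .{{_ : NonZero n}} → Aut n → Set
IsIdentity {n} g = ∀ (v : Fin n) → act g v ≡ v

Coloring : ℕ → ℕ → Set
Coloring n k = Fin n → Fin k

Distinguishing : ∀ {n k} .{{_ : NonZero n}} → Coloring n k → Set
Distinguishing {n} c = ∀ (g : Aut n) → (∀ v → c (act g v) ≡ c v) → IsIdentity g

IsDistNumber : ∀ n .{{_ : NonZero n}} → ℕ → Set
IsDistNumber n d =
  Σ (Coloring n d) Distinguishing ×
  (∀ k → k < d → ¬ Σ (Coloring n k) Distinguishing)

FixingSet : ∀ {n} .{{_ : NonZero n}} → Subset n → Set
FixingSet {n} S = ∀ (g : Aut n) → ¬ IsIdentity g → ∃ λ s → s ∈ S × act g s ≢ s

-- the property defining ext_D: for every fixing set W with |W| ≥ m, every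
-- coloring of V \ W with d colors extends to a distinguishing d-coloring.
-- (A coloring of V \ W is represented by f : Fin n → Fin d, whose values
--  on W are ignored.)
ExtProp : ∀ n .{{_ : NonZero n}} → ℕ → ℕ → Set
ExtProp n d m =
  ∀ (W : Subset n) → FixingSet W → m ≤ ∣ W ∣ →
  ∀ (f : Coloring n d) →
  Σ (Coloring n d) λ c → Distinguishing c × (∀ v → v ∉ W → c v ≡ f v)

IsExtD : ∀ n .{{_ : NonZero n}} → ℕ → ℕ → Set
IsExtD n d e = ExtProp n d e × (∀ m → m < e → ¬ ExtProp n d m)

{-# OPTIONS --safe #-}
-- Colourings of the cycle are periodic colourings c of ℤ, and reflections are
-- written v ↦ 2x − v with centre x, which is possible because n is odd.
--
-- Upper bound. Pick four points in W and suppose that all sixteen colourings of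
-- them extend to a symmetric colouring. At most one of the sixteen is invariant
-- under a nontrivial rotation, so there is a colouring from which up to three
-- toggles of the four points only lead to colourings with exactly one reflection.
-- If toggling a and b moves the centre x to y and z, then c is almost invariant
-- under the translations by 2(y − x) and 2(z − x); comparing the two orders of
-- composition forces one of four linear configurations: y and z are the midpoints
-- of x with a and b, or one of the three cases of Related. Following these
-- relations through a few toggles forces some difference of the points to be
-- killed by 2, 3 or 5, which are invertible modulo n.
--
-- Lower bound. Colour everything outside three consecutive vertices alike: every
-- colouring of these three then has a reflection.
module Submission where

open import Defs
open import Data.Bool using (Bool; true; false; not; _xor_)
open import Data.Bool.Properties using (not-injective; not-¬; xor-assoc; xor-comm; xor-identityʳ; xor-same) renaming (_≟_ to _≟ᵇ_)
open import Data.Bool.Solver using (module xor-∧-Solver)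
open import Data.Empty using (⊥; ⊥-elim)
open import Data.Fin as Fin using (Fin; zero; suc; _≟_; toℕ; fromℕ<)
open import Data.Fin.Patterns using (0F; 1F; 2F; 3F)
open import Data.Fin.Properties using (any?; all?; pigeonhole; suc-injective; toℕ<n; toℕ-fromℕ<; toℕ-injective)
open import Data.Fin.Subset as Subset using (Subset; inside; outside; _∈_; _∉_)
open import Data.Fin.Subset.Properties using (anySubset?; ∉⊥; ∣⊤∣≡n)
open import Data.Integer as ℤ using (ℤ; +_; -_; _+_; _-_; _*_; 0ℤ; 1ℤ; -1ℤ)
open import Data.Integer.Coprimality using (coprime-divisor)
open import Data.Integer.DivMod using (_%ℕ_; _/ℕ_; n%ℕd<d; a≡a%ℕn+[a/ℕn]*n)
open import Data.Integer.Divisibility.Signed using (divides; ∣ᵤ⇒∣; ∣⇒∣ᵤ; ∣m∣n⇒∣m+n; ∣n⇒∣m*n) renaming (_∣_ to _∣ᶻ_; _∣?_ to _∣ᶻ?_)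
import Data.Integer.Properties as ℤₚ
open import Data.Integer.Tactic.RingSolver using (solve-∀)
open import Data.List using (List; []; _∷_; foldr; length)
open import Data.List.Membership.DecPropositional {A = Fin 4} _≟_ using () renaming (_∈?_ to _∈ˡ?_)
open import Data.List.Membership.Propositional using () renaming (_∈_ to _∈ˡ_)
open import Data.List.Membership.Setoid.Properties using (index-injective)
open import Data.List.Relation.Unary.Any using (here; there; index)
open import Data.Nat as ℕ using (ℕ; NonZero; _∸_; _≤_; _<_; _≤?_; z≤n; s≤s)
open import Data.Nat.DivMod using (_%_; _/_; m%n<n; m≡m%n+[m/n]*n)
open import Data.Nat.Divisibility using (_∣_; >⇒∤; m%n≡0⇒n∣m) renaming (divides to dividesℕ)
open import Data.Nat.Primality using (Prime; prime?; prime⇒irreducible)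
import Data.Nat.Properties as ℕₚ
open import Data.Product using (Σ; ∃; _×_; _,_; proj₁; proj₂; map₂)
open import Data.Sum using (_⊎_; inj₁; inj₂; [_,_]′)
open import Data.Vec using (Vec; []; _∷_; allFin; lookup; map; replicate; tabulate; updateAt; zipWith) renaming (here to hereᵛ; there to thereᵛ)
open import Data.Vec.N-ary using (N-ary; _$ⁿ_)
open import Data.Vec.Properties using (lookup∘tabulate)
open import Function using (_∘_; mk⇔)
open import Relation.Binary.PropositionalEquality
open import Relation.Nullary using (¬_; Dec; does; yes; no; ¬?)
open import Relation.Nullary.Decidable using (True; toWitness; decidable-stable; dec-false; dec-true; does-⇔; from-yes; map′; _×-dec_; _→-dec_)

-- Linear congruences

-- Syntax for integer linear forms. A linear consequence of congruences is then proved by supplying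
-- integer multipliers for the hypotheses and comparing two coefficient vectors, which `refl` does.
data Lin (m : ℕ) : Set where
  nil     : Lin m
  var     : Fin m → Lin m
  _⊕_ _⊖_ : Lin m → Lin m → Lin m

infixl 6 _⊕_ _⊖_

⟦_⟧ : ∀ {m} → Lin m → Vec ℤ m → ℤ
⟦ nil ⟧   ρ = 0ℤ
⟦ var i ⟧ ρ = lookup ρ i
⟦ s ⊕ t ⟧ ρ = ⟦ s ⟧ ρ + ⟦ t ⟧ ρ
⟦ s ⊖ t ⟧ ρ = ⟦ s ⟧ ρ - ⟦ t ⟧ ρ

unit : ∀ {m} → Fin m → Vec ℤ m
unit i = updateAt (replicate _ 0ℤ) i (λ _ → 1ℤ)

combine : ∀ {m} → ℤ → Vec ℤ m → Vec ℤ m → Vec ℤ m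
combine k = zipWith (λ x y → x + k * y)

coefficients : ∀ {m} → Lin m → Vec ℤ m
coefficients nil     = replicate _ 0ℤ
coefficients (var i) = unit i
coefficients (s ⊕ t) = combine 1ℤ (coefficients s) (coefficients t)
coefficients (s ⊖ t) = combine -1ℤ (coefficients s) (coefficients t)

infix 8 _•_

_•_ : ∀ {m} → Vec ℤ m → Vec ℤ m → ℤ
[] • [] = 0ℤ
(x ∷ xs) • (y ∷ ys) = x * y + xs • ys

zero-• : ∀ {m} (ρ : Vec ℤ m) → replicate m 0ℤ • ρ ≡ 0ℤ
zero-• []      = refl
zero-• (y ∷ ρ) = trans (ℤₚ.+-identityˡ _) (zero-• ρ)

unit-• : ∀ {m} (i : Fin m) (ρ : Vec ℤ m) → unit i • ρ ≡ lookup ρ i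
unit-• zero    (y ∷ ρ) =
  trans (cong (_+_ (1ℤ * y)) (zero-• ρ)) (trans (ℤₚ.+-identityʳ _) (ℤₚ.*-identityˡ y))
unit-• (suc i) (y ∷ ρ) = trans (ℤₚ.+-identityˡ _) (unit-• i ρ)

combine-• : ∀ {m} k (xs ys ρ : Vec ℤ m) → combine k xs ys • ρ ≡ xs • ρ + k * (ys • ρ)
combine-• k []       []       []      = sym (trans (ℤₚ.+-identityˡ _) (ℤₚ.*-zeroʳ k))
combine-• k (x ∷ xs) (y ∷ ys) (r ∷ ρ) =
  trans (cong (_+_ ((x + k * y) * r)) (combine-• k xs ys ρ)) (regroup k x y r (xs • ρ) (ys • ρ))
  where
  regroup : ∀ k x y r s t → (x + k * y) * r + (s + k * t) ≡ x * r + s + k * (y * r + t)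
  regroup = solve-∀

⟦⟧-• : ∀ {m} (t : Lin m) (ρ : Vec ℤ m) → ⟦ t ⟧ ρ ≡ coefficients t • ρ
⟦⟧-• nil     ρ = sym (zero-• ρ)
⟦⟧-• (var i) ρ = sym (unit-• i ρ)
⟦⟧-• (s ⊕ t) ρ = trans (cong₂ _+_ (⟦⟧-• s ρ) (⟦⟧-• t ρ))
  (sym (trans (combine-• 1ℤ (coefficients s) (coefficients t) ρ)
              (cong (_+_ (coefficients s • ρ)) (ℤₚ.*-identityˡ _))))
⟦⟧-• (s ⊖ t) ρ = trans (cong₂ _-_ (⟦⟧-• s ρ) (⟦⟧-• t ρ))
  (sym (trans (combine-• -1ℤ (coefficients s) (coefficients t) ρ)
              (cong (_+_ (coefficients s • ρ)) (ℤₚ.-1*i≡-i _))))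

infix 5 _≐_
infix 4 _⊢_

data Equation (m : ℕ) : Set where
  _≐_ : Lin m → Lin m → Equation m

difference : ∀ {m} → Equation m → Lin m
difference (s ≐ t) = s ⊖ t

-- A hypothesis carries the coefficient with which it enters the linear combination.
data Sequent (m : ℕ) : Set where
  _⊢_ : List (ℤ × Equation m) → Equation m → Sequent m

-- Lets a sequent be written as a function of named variables; applying the function to the formal
-- variables turns it into syntax.
close : ∀ {m} {A : Set} → N-ary m (Lin m) A → A
close {A = A} f = _$ⁿ_ {B = A} f (map var (allFin _))

module Congruence (n : ℕ) where

  infix 4 _≈_ _≉_ _≈?_

  -- Wrapped in a record so that `i` and `j` can be read off from the type of a proof; the bare
  -- divisibility mentions them only through their difference.
  record _≈_ (i j : ℤ) : Set where
    constructor congruent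
    field
      divisibility : + n ∣ᶻ i - j

  open _≈_

  _≉_ : ℤ → ℤ → Set
  i ≉ j = ¬ i ≈ j

  record Cancellable (k : ℤ) : Set where
    field
      cancel : ∀ i → + n ∣ᶻ k * i → + n ∣ᶻ i

  open Cancellable

  Holds : ∀ {m} → Vec ℤ m → Equation m → Set
  Holds ρ (s ≐ t) = ⟦ s ⟧ ρ ≈ ⟦ t ⟧ ρ

  Valid : ∀ {m} → Vec ℤ m → Sequent m → Set
  Valid ρ ([] ⊢ g)           = Holds ρ g
  Valid ρ ((_ , h) ∷ hs ⊢ g) = Holds ρ h → Valid ρ (hs ⊢ g)

  total : ∀ {m} → Vec ℤ m → List (ℤ × Equation m) → Vec ℤ m
  total acc []             = acc
  total acc ((c , h) ∷ hs) = total (combine c acc (coefficients (difference h))) hs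

  -- The combination of the hypotheses is k times the conclusion, and k can be cancelled.
  Certified : ∀ {m} → ℤ → Sequent m → Set
  Certified k (hs ⊢ g) =
    total (replicate _ 0ℤ) hs ≡ combine k (replicate _ 0ℤ) (coefficients (difference g))

  module _ {m} (ρ : Vec ℤ m) where

    -- Each hypothesis adds a multiple of a number divisible by `n`, so the value of the accumulated
    -- form at `ρ` stays divisible by `n`. At the end this value is `k` times the difference of the
    -- two sides of the goal.
    accumulate : ∀ {k} → Cancellable k → ∀ acc hs g → + n ∣ᶻ acc • ρ →
      total acc hs ≡ combine k (replicate m 0ℤ) (coefficients (difference g)) → Valid ρ (hs ⊢ g)
    accumulate {k} c acc [] (s ≐ t) n∣acc eq = congruent (cancel c _ (subst (+ n ∣ᶻ_) value n∣acc))
      where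
      open ≡-Reasoning
      cs = coefficients (s ⊖ t)
      value : acc • ρ ≡ k * ⟦ s ⊖ t ⟧ ρ
      value = begin
        acc • ρ                              ≡⟨ cong (_• ρ) eq ⟩
        combine k (replicate m 0ℤ) cs • ρ    ≡⟨ combine-• k (replicate m 0ℤ) cs ρ ⟩
        replicate m 0ℤ • ρ + k * (cs • ρ)    ≡⟨ cong₂ _+_ (zero-• ρ) (cong (k *_) (sym (⟦⟧-• (s ⊖ t) ρ))) ⟩
        0ℤ + k * ⟦ s ⊖ t ⟧ ρ                 ≡⟨ ℤₚ.+-identityˡ _ ⟩
        k * ⟦ s ⊖ t ⟧ ρ                      ∎
    accumulate ck acc ((c , s ≐ t) ∷ hs) g n∣acc eq h =
      accumulate ck _ hs g (subst (+ n ∣ᶻ_) (sym value) (∣m∣n⇒∣m+n n∣acc (∣n⇒∣m*n c (divisibility h)))) eq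
      where
      value : combine c acc (coefficients (s ⊖ t)) • ρ ≡ acc • ρ + c * ⟦ s ⊖ t ⟧ ρ
      value = trans (combine-• c acc (coefficients (s ⊖ t)) ρ)
                    (cong (λ i → acc • ρ + c * i) (sym (⟦⟧-• (s ⊖ t) ρ)))

  abstract
    derive : ∀ {m k} → Cancellable k → (ρ : Vec ℤ m) (s : Sequent m) → Certified k s → Valid ρ s
    derive c ρ (hs ⊢ g) = accumulate ρ c (replicate _ 0ℤ) hs g
      (subst (+ n ∣ᶻ_) (sym (zero-• ρ)) (divides 0ℤ refl))

  deduce : ∀ {m k} → Cancellable k → (ρ : Vec ℤ m) (f : N-ary m (Lin m) (Sequent m)) →
    Certified k (close f) → Valid ρ (close f)
  deduce c ρ f = derive c ρ (close f)

  one : Cancellable 1ℤ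
  one .cancel i = subst (+ n ∣ᶻ_) (ℤₚ.*-identityˡ i)

  ≈-refl : ∀ {i} → i ≈ i
  ≈-refl {i} = deduce one (i ∷ [])
      (λ i → [] ⊢ i ≐ i) refl

  ≈-sym : ∀ {i j} → i ≈ j → j ≈ i
  ≈-sym {i} {j} = deduce one (i ∷ j ∷ [])
      (λ i j → (-1ℤ , i ≐ j) ∷ [] ⊢ j ≐ i) refl

  abstract
    _≈?_ : ∀ i j → Dec (i ≈ j)
    i ≈? j = map′ congruent divisibility (+ n ∣ᶻ? i - j)

-- Colourings of ℤ

true-sound : ∀ {A : Set} (a? : Dec A) → does a? ≡ true → A
true-sound (yes a) _ = a

module _ where
  open xor-∧-Solver using (solve; _:=_; _:+_)

  xor-swap : ∀ a b c d → b xor (a xor (c xor d)) ≡ a xor (b xor (c xor d))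
  xor-swap = solve 4 (λ a b c d → b :+ (a :+ (c :+ d)) := a :+ (b :+ (c :+ d))) refl

  xor-exchange : ∀ a b c d → c xor (d xor (a xor b)) ≡ a xor (b xor (c xor d))
  xor-exchange = solve 4 (λ a b c d → c :+ (d :+ (a :+ b)) := a :+ (b :+ (c :+ d))) refl

  xor-rotate : ∀ a b c d → d xor (c xor (a xor b)) ≡ a xor (b xor (c xor d))
  xor-rotate = solve 4 (λ a b c d → d :+ (c :+ (a :+ b)) := a :+ (b :+ (c :+ d))) refl

  -- For use with pᵢ and nᵢ the indicators of uᵢ and -uᵢ. Each of the eight stands on exactly one
  -- side of the hypothesis, so adding the two sides cancels `c` and leaves the sum of all eight.
  xor-balance : ∀ c p₁ n₁ p₂ n₂ p₃ n₃ p₄ n₄ →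
    (((c xor n₃) xor p₄) xor n₂) xor p₁ ≡ (((c xor n₁) xor p₂) xor n₄) xor p₃ →
    (p₁ xor n₁) xor ((p₂ xor n₂) xor ((p₃ xor n₃) xor (p₄ xor n₄))) ≡ false
  xor-balance c p₁ n₁ p₂ n₂ p₃ n₃ p₄ n₄ eq = trans
    (regroup c p₁ n₁ p₂ n₂ p₃ n₃ p₄ n₄)
    (trans (cong (_xor ((((c xor n₁) xor p₂) xor n₄) xor p₃)) eq)
           (xor-same ((((c xor n₁) xor p₂) xor n₄) xor p₃)))
    where
    regroup : ∀ c p₁ n₁ p₂ n₂ p₃ n₃ p₄ n₄ →
      (p₁ xor n₁) xor ((p₂ xor n₂) xor ((p₃ xor n₃) xor (p₄ xor n₄))) ≡
      ((((c xor n₃) xor p₄) xor n₂) xor p₁) xor ((((c xor n₁) xor p₂) xor n₄) xor p₃)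
    regroup = solve 9 (λ c p₁ n₁ p₂ n₂ p₃ n₃ p₄ n₄ →
      (p₁ :+ n₁) :+ ((p₂ :+ n₂) :+ ((p₃ :+ n₃) :+ (p₄ :+ n₄))) :=
      ((((c :+ n₃) :+ p₄) :+ n₂) :+ p₁) :+ ((((c :+ n₁) :+ p₂) :+ n₄) :+ p₃)) refl

xor-injectiveʳ : ∀ p {q r} → p xor q ≡ p xor r → q ≡ r
xor-injectiveʳ false eq = eq
xor-injectiveʳ true  eq = not-injective eq

xor-injectiveˡ : ∀ {p q} r → p xor r ≡ q xor r → p ≡ q
xor-injectiveˡ {p} {q} r eq = xor-injectiveʳ r (trans (xor-comm r p) (trans eq (xor-comm q r)))

module Colourings (n : ℕ)
  (two : Congruence.Cancellable n (+ 2)) (three : Congruence.Cancellable n (+ 3))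
  (five : Congruence.Cancellable n (+ 5)) where

  open Congruence n

  cancel-* : ∀ {k l} → Cancellable k → Cancellable l → Cancellable (k * l)
  cancel-* {k} {l} ck cl .Cancellable.cancel i n∣kli =
    Cancellable.cancel cl i (Cancellable.cancel ck (l * i) (subst (+ n ∣ᶻ_) (ℤₚ.*-assoc k l i) n∣kli))

  four : Cancellable (+ 4)
  four = cancel-* two two

  Colouring : Set
  Colouring = ℤ → Bool

  Periodic : Colouring → Set
  Periodic c = ∀ {u v} → u ≈ v → c u ≡ c v

  Invariant : ℤ → Colouring → Set
  Invariant α c = ∀ v → c (v + α) ≡ c v

  Symmetric : ℤ → Colouring → Set
  Symmetric x c = ∀ v → c (x + x - v) ≡ c v

  RotationFree : Colouring → Set
  RotationFree c = ∀ α → Invariant α c → α ≈ 0ℤ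

  χ : ℤ → Colouring
  χ a v = does (v ≈? a)

  χ-cong : ∀ a v a′ v′ → v - a ≈ v′ - a′ → χ a v ≡ χ a′ v′
  χ-cong a v a′ v′ e = does-⇔ (mk⇔
    (deduce one (v ∷ a ∷ v′ ∷ a′ ∷ [])
        (λ v a v′ a′ → (-1ℤ , v ⊖ a ≐ v′ ⊖ a′) ∷ (1ℤ , v ≐ a) ∷ [] ⊢ v′ ≐ a′) refl e)
    (deduce one (v ∷ a ∷ v′ ∷ a′ ∷ [])
        (λ v a v′ a′ → (1ℤ , v ⊖ a ≐ v′ ⊖ a′) ∷ (1ℤ , v′ ≐ a′) ∷ [] ⊢ v ≐ a) refl
          e)) (v ≈? a) (v′ ≈? a′)

  χ-refl : ∀ a → χ a a ≡ true
  χ-refl a = dec-true (a ≈? a) ≈-refl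

  χ-true : ∀ {a v} → χ a v ≡ true → v ≈ a
  χ-true {a} {v} = true-sound (v ≈? a)

  χ-false : ∀ {a v} → v ≉ a → χ a v ≡ false
  χ-false {a} {v} = dec-false (v ≈? a)

  χ-mirror : ∀ a b v → χ a (b - v) ≡ χ (b - a) v
  χ-mirror a b v = does-⇔ (mk⇔
    (deduce one (a ∷ b ∷ v ∷ [])
        (λ a b v → (-1ℤ , b ⊖ v ≐ a) ∷ [] ⊢ v ≐ b ⊖ a) refl)
    (deduce one (a ∷ b ∷ v ∷ [])
        (λ a b v → (-1ℤ , v ≐ b ⊖ a) ∷ [] ⊢ b ⊖ v ≐ a) refl)) (b - v ≈? a) (v ≈? b - a)

  infixl 6 _⊞_

  _⊞_ : Colouring → ℤ → Colouring
  (c ⊞ a) v = c v xor χ a v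

  ⊞-periodic : ∀ {c} a → Periodic c → Periodic (c ⊞ a)
  ⊞-periodic a per {u} {v} u≈v = cong₂ _xor_ (per u≈v)
    (χ-cong a u a v (deduce one (u ∷ v ∷ a ∷ [])
        (λ u v a → (1ℤ , u ≐ v) ∷ [] ⊢ u ⊖ a ≐ v ⊖ a) refl u≈v))

  record Good (c : Colouring) (x : ℤ) : Set where
    field
      periodic     : Periodic c
      symmetric    : Symmetric x c
      rotationFree : RotationFree c

  open Good

  -- Two reflections of the same colouring compose to the translation by 2x - 2y. Without rotations
  -- this translation is trivial, and 2 can be cancelled.
  centre-unique : ∀ {c c′ x y} → (∀ v → c v ≡ c′ v) → Good c x → Good c′ y → x ≈ y
  centre-unique {c} {c′} {x} {y} c≗c′ g g′ =
    deduce two (x ∷ y ∷ [])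
        (λ x y → (1ℤ , x ⊕ x ⊖ (y ⊕ y) ≐ nil) ∷ [] ⊢ x ≐ y) refl
          (rotationFree g (x + x - (y + y)) invariant)
    where
    open ≡-Reasoning
    invariant : Invariant (x + x - (y + y)) c
    invariant v = begin
      c (v + (x + x - (y + y)))      ≡⟨ periodic g (deduce one (x ∷ y ∷ v ∷ [])
          (λ x y v → [] ⊢ v ⊕ (x ⊕ x ⊖ (y ⊕ y)) ≐ x ⊕ x ⊖ (y ⊕ y ⊖ v)) refl) ⟩
      c (x + x - (y + y - v))        ≡⟨ symmetric g _ ⟩
      c (y + y - v)                  ≡⟨ c≗c′ _ ⟩
      c′ (y + y - v)                 ≡⟨ symmetric g′ v ⟩
      c′ v                           ≡⟨ c≗c′ v ⟨
      c v                            ∎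

  -- The composition of the reflections about x and y is the translation by 2y − 2x.
  toggle-shift : ∀ {c a x y} → Periodic c → Symmetric x c → Symmetric y (c ⊞ a) → ∀ v →
    c (v + (y + y - (x + x))) ≡ (c v xor χ (x + x - a) v) xor χ (a - (y + y - (x + x))) v
  toggle-shift {c} {a} {x} {y} per sym-x sym-y v = begin
    c v′                                                ≡⟨ cancel (c v′) (χ a v′) ⟨
    (c v′ xor χ a v′) xor χ a v′                        ≡⟨ cong₂ _xor_ moved (χ-cong a v′ (a - δ) v (deduce one (v ∷ a ∷ x ∷ y ∷ [])
        (λ v a x y → [] ⊢ v ⊕ (y ⊕ y ⊖ (x ⊕ x)) ⊖ a ≐ v ⊖ (a ⊖ (y ⊕ y ⊖ (x ⊕ x)))) refl)) ⟩
    (c v xor χ (x + x - a) v) xor χ (a - δ) v           ∎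
    where
    open ≡-Reasoning
    δ  = y + y - (x + x)
    v′ = v + δ
    cancel : ∀ p q → (p xor q) xor q ≡ p
    cancel p q = trans (xor-assoc p q q) (trans (cong (p xor_) (xor-same q)) (xor-identityʳ p))
    moved : c v′ xor χ a v′ ≡ c v xor χ (x + x - a) v
    moved = begin
      (c ⊞ a) v′                            ≡⟨ ⊞-periodic {c} a per (deduce one (v ∷ x ∷ y ∷ [])
          (λ v x y → [] ⊢ v ⊕ (y ⊕ y ⊖ (x ⊕ x)) ≐ y ⊕ y ⊖ (x ⊕ x ⊖ v)) refl) ⟩
      (c ⊞ a) (y + y - (x + x - v))         ≡⟨ sym-y (x + x - v) ⟩
      c (x + x - v) xor χ a (x + x - v)     ≡⟨ cong₂ _xor_ (sym-x v) (χ-mirror a (x + x) v) ⟩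
      c v xor χ (x + x - a) v               ∎

  -- Matching points up to sign

  infix 4 _≈±_

  data _≈±_ (u v : ℤ) : Set where
    same     : u ≈ v → u ≈± v
    opposite : u ≈ 0ℤ - v → u ≈± v

  ≈±-sym : ∀ {u v} → u ≈± v → v ≈± u
  ≈±-sym {u} {v} (same e) = same (≈-sym e)
  ≈±-sym {u} {v} (opposite e) = opposite (deduce one (u ∷ v ∷ [])
      (λ u v → (1ℤ , u ≐ nil ⊖ v) ∷ [] ⊢ v ≐ nil ⊖ u) refl e)

  ≈±-trans : ∀ {u v w} → u ≈± v → v ≈± w → u ≈± w
  ≈±-trans {u} {v} {w} (same e) (same f) = same (deduce one (u ∷ v ∷ w ∷ [])
      (λ u v w → (1ℤ , u ≐ v) ∷ (1ℤ , v ≐ w) ∷ [] ⊢ u ≐ w) refl e f)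
  ≈±-trans {u} {v} {w} (same e) (opposite f) = opposite (deduce one (u ∷ v ∷ w ∷ [])
      (λ u v w → (1ℤ , u ≐ v) ∷ (1ℤ , v ≐ nil ⊖ w) ∷ [] ⊢ u ≐ nil ⊖ w) refl e f)
  ≈±-trans {u} {v} {w} (opposite e) (same f) = opposite (deduce one (u ∷ v ∷ w ∷ [])
      (λ u v w → (1ℤ , u ≐ nil ⊖ v) ∷ (-1ℤ , v ≐ w) ∷ [] ⊢ u ≐ nil ⊖ w) refl e f)
  ≈±-trans {u} {v} {w} (opposite e) (opposite f) = same (deduce one (u ∷ v ∷ w ∷ [])
      (λ u v w → (1ℤ , u ≐ nil ⊖ v) ∷ (-1ℤ , v ≐ nil ⊖ w) ∷ [] ⊢ u ≐ w) refl e f)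

  zeros : ∀ {u v} → u ≈ 0ℤ → v ≈ 0ℤ → u ≈± v
  zeros {u} {v} e f = same (deduce one (u ∷ v ∷ [])
      (λ u v → (1ℤ , u ≐ nil) ∷ (-1ℤ , v ≐ nil) ∷ [] ⊢ u ≐ v) refl e f)

  -- The indicator of the pair {u, -u} modulo 2. It vanishes identically when u ≈ 0, which is why
  -- `Partner` must allow that case.
  χ± : ℤ → Colouring
  χ± u v = χ u v xor χ (0ℤ - u) v

  χ±-true : ∀ {u v} → χ± u v ≡ true → v ≈± u
  χ±-true {u} {v} eq with χ u v in p | χ (0ℤ - u) v in q
  ... | true  | _    = same (χ-true p)
  ... | false | true = opposite (χ-true q)

  χ±-self : ∀ {u} → u ≉ 0ℤ → χ± u u ≡ true
  χ±-self {u} u≉0 = cong₂ _xor_ (χ-refl u) (χ-false λ e → u≉0 (deduce two (u ∷ [])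
      (λ u → (1ℤ , u ≐ nil ⊖ u) ∷ [] ⊢ u ≐ nil) refl e))

  Partner : (u p q r : ℤ) → Set
  Partner u p q r = u ≈ 0ℤ ⊎ (u ≈± p ⊎ u ≈± q ⊎ u ≈± r)

  -- If u ≉ 0, then u and -u are distinct because 2 is cancellable, so the first summand is `true`.
  -- An even total then needs one of the other pairs to contain u.
  partner : ∀ u p q r → χ± u u xor (χ± p u xor (χ± q u xor χ± r u)) ≡ false →
    Partner u p q r
  partner u p q r eq with u ≈? 0ℤ
  ... | yes u≈0 = inj₁ u≈0
  ... | no  u≉0 with χ± u u | χ±-self u≉0 | χ± p u in ep | χ± q u in eq′ | χ± r u in er
  ...   | _ | refl | true  | _     | _    = inj₂ (inj₁ (χ±-true ep))
  ...   | _ | refl | false | true  | _    = inj₂ (inj₂ (inj₁ (χ±-true eq′)))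
  ...   | _ | refl | false | false | true = inj₂ (inj₂ (inj₂ (χ±-true er)))

  partner-swap : ∀ {u p q r} → Partner u p q r → Partner u p r q
  partner-swap (inj₁ e)               = inj₁ e
  partner-swap (inj₂ (inj₁ e))        = inj₂ (inj₁ e)
  partner-swap (inj₂ (inj₂ (inj₁ e))) = inj₂ (inj₂ (inj₂ e))
  partner-swap (inj₂ (inj₂ (inj₂ e))) = inj₂ (inj₂ (inj₁ e))

  -- Once u₁ is matched with u₃, neither can be matched with u₂, since both agree with u₁ up to
  -- sign. So u₂ is matched with u₄, or it vanishes; in the latter case u₄ vanishes too or is
  -- matched with u₂.
  second-pair : ∀ {u₁ u₂ u₃ u₄} → ¬ u₁ ≈± u₂ → ¬ u₃ ≈± u₄ →
    Partner u₂ u₁ u₃ u₄ → Partner u₄ u₃ u₁ u₂ → u₁ ≈± u₃ → u₂ ≈± u₄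
  second-pair ≉₁₂ ≉₃₄ (inj₂ (inj₁ f))        _ e = ⊥-elim (≉₁₂ (≈±-sym f))
  second-pair ≉₁₂ ≉₃₄ (inj₂ (inj₂ (inj₁ f))) _ e = ⊥-elim (≉₁₂ (≈±-trans e (≈±-sym f)))
  second-pair ≉₁₂ ≉₃₄ (inj₂ (inj₂ (inj₂ f))) _ e = f
  second-pair ≉₁₂ ≉₃₄ (inj₁ u₂≈0) (inj₁ u₄≈0)            e = zeros u₂≈0 u₄≈0
  second-pair ≉₁₂ ≉₃₄ (inj₁ u₂≈0) (inj₂ (inj₁ f))        e = ⊥-elim (≉₃₄ (≈±-sym f))
  second-pair ≉₁₂ ≉₃₄ (inj₁ u₂≈0) (inj₂ (inj₂ (inj₁ f))) e = ⊥-elim (≉₃₄ (≈±-sym (≈±-trans f e)))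
  second-pair ≉₁₂ ≉₃₄ (inj₁ u₂≈0) (inj₂ (inj₂ (inj₂ f))) e = ≈±-sym f

  -- As the partners inside {u₁, u₂} and inside {u₃, u₄} are excluded, the matching must cross
  -- between the two sets. At most one of u₁ and u₂ vanishes, so one of them has a proper partner
  -- from which `second-pair` can start.
  pairing : ∀ {u₁ u₂ u₃ u₄} → ¬ u₁ ≈± u₂ → ¬ u₃ ≈± u₄ →
    Partner u₁ u₂ u₃ u₄ → Partner u₂ u₁ u₃ u₄ → Partner u₃ u₄ u₁ u₂ → Partner u₄ u₃ u₁ u₂ →
    (u₁ ≈± u₃ × u₂ ≈± u₄) ⊎ (u₁ ≈± u₄ × u₂ ≈± u₃)
  pairing ≉₁₂ ≉₃₄ (inj₂ (inj₁ e)) _ _ _ = ⊥-elim (≉₁₂ e)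
  pairing ≉₁₂ ≉₃₄ (inj₂ (inj₂ (inj₁ e))) p₂ p₃ p₄ = inj₁ (e , second-pair ≉₁₂ ≉₃₄ p₂ p₄ e)
  pairing ≉₁₂ ≉₃₄ (inj₂ (inj₂ (inj₂ e))) p₂ p₃ p₄ =
    inj₂ (e , second-pair ≉₁₂ (≉₃₄ ∘ ≈±-sym) (partner-swap p₂) p₃ e)
  pairing ≉₁₂ ≉₃₄ (inj₁ u₁≈0) (inj₁ u₂≈0) _ _ = ⊥-elim (≉₁₂ (zeros u₁≈0 u₂≈0))
  pairing ≉₁₂ ≉₃₄ (inj₁ u₁≈0) (inj₂ (inj₁ e)) _ _ = ⊥-elim (≉₁₂ (≈±-sym e))
  pairing ≉₁₂ ≉₃₄ p₁@(inj₁ _) (inj₂ (inj₂ (inj₁ e))) p₃ p₄ =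
    inj₂ (second-pair (≉₁₂ ∘ ≈±-sym) ≉₃₄ p₁ (partner-swap p₄) e , e)
  pairing ≉₁₂ ≉₃₄ p₁@(inj₁ _) (inj₂ (inj₂ (inj₂ e))) p₃ p₄ =
    inj₁ (second-pair (≉₁₂ ∘ ≈±-sym) (≉₃₄ ∘ ≈±-sym) (partner-swap p₁) (partner-swap p₃) e , e)

  -- In the notation of `Related`: for `mirrored`, the reflection about x exchanges a with b and y
  -- with z; for `stepped`, the translation by 2(y - x) carries b to a and the one by 2(z - x)
  -- carries a to b; for `merged`, both new centres are the midpoint of a and b.
  data Relation : Set where
    mirrored stepped merged : Relation

  -- Here x is the centre of c, and y and z are the centres of c ⊞ a and c ⊞ b.
  data Related : Relation → (x a b y z : ℤ) → Set where
    mirror : ∀ {x a b y z} → a + b ≈ x + x → y + z ≈ x + x → Related mirrored x a b y z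
    step   : ∀ {x a b y z} → y + y + b ≈ x + x + a → z + z + a ≈ x + x + b → Related stepped x a b y z
    merge  : ∀ {x a b y z} → y + y ≈ a + b → z + z ≈ a + b → Related merged x a b y z

  Midpoint : (x a y : ℤ) → Set
  Midpoint x a y = y + y ≈ x + a

  module _ {c x a b y z} (good : Good c x) (good-a : Good (c ⊞ a) y) (good-b : Good (c ⊞ b) z)
    where

    -- Translating c by δ + ε in the two possible orders gives two expressions for the
    -- same colour, so the eight points ±uᵢ cancel modulo 2.
    evenly-covered : ∀ v →
      χ± (a + x - y - z) v xor (χ± (a - x - y + z) v xor (χ± (b + x - y - z) v xor χ± (b - x + y - z) v))
      ≡ false
    evenly-covered v = xor-balance (c t) (χ u₁ v) (χ (0ℤ - u₁) v) (χ u₂ v) (χ (0ℤ - u₂) v)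
      (χ u₃ v) (χ (0ℤ - u₃) v) (χ u₄ v) (χ (0ℤ - u₄) v) (trans (sym y-last) (trans commute z-last))
      where
      u₁ u₂ u₃ u₄ t δ ε : ℤ
      u₁ = a + x - y - z
      u₂ = a - x - y + z
      u₃ = b + x - y - z
      u₄ = b - x + y - z
      -- This offset places `t` and `t + δ + ε` symmetrically about `v + x`; with it the eight
      -- exceptional positions of the two translations become the pairs uᵢ and -uᵢ.
      t = v + (x + x + x - y - z)
      δ = y + y - (x + x)
      ε = z + z - (x + x)
      shift-a : ∀ s → c (s + δ) ≡ (c s xor χ (x + x - a) s) xor χ (a - δ) s
      shift-a = toggle-shift {c} {a} {x} {y} (periodic good) (symmetric good) (symmetric good-a)
      shift-b : ∀ s → c (s + ε) ≡ (c s xor χ (x + x - b) s) xor χ (b - ε) s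
      shift-b = toggle-shift {c} {b} {x} {z} (periodic good) (symmetric good) (symmetric good-b)
      commute : c (t + ε + δ) ≡ c (t + δ + ε)
      commute = periodic good (deduce one (t ∷ δ ∷ ε ∷ [])
          (λ t d e → [] ⊢ t ⊕ e ⊕ d ≐ t ⊕ d ⊕ e) refl)
      y-last : c (t + ε + δ) ≡ (((c t xor χ (0ℤ - u₃) v) xor χ u₄ v) xor χ (0ℤ - u₂) v) xor χ u₁ v
      y-last = trans (shift-a (t + ε)) (cong₂ _xor_ (cong₂ _xor_
        (trans (shift-b t) (cong₂ _xor_ (cong (c t xor_)
          (χ-cong (x + x - b) t (0ℤ - u₃) v (deduce one (v ∷ x ∷ y ∷ z ∷ b ∷ [])
              (λ v x y z b → []
                 ⊢ v ⊕ (x ⊕ x ⊕ x ⊖ y ⊖ z) ⊖ (x ⊕ x ⊖ b) ≐ v ⊖ (nil ⊖ (b ⊕ x ⊖ y ⊖ z))) refl)))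
          (χ-cong (b - ε) t u₄ v (deduce one (v ∷ x ∷ y ∷ z ∷ b ∷ [])
              (λ v x y z b → []
                 ⊢ v ⊕ (x ⊕ x ⊕ x ⊖ y ⊖ z) ⊖ (b ⊖ (z ⊕ z ⊖ (x ⊕ x))) ≐ v ⊖ (b ⊖ x ⊕ y ⊖ z)) refl))))
        (χ-cong (x + x - a) (t + ε) (0ℤ - u₂) v (deduce one (v ∷ x ∷ y ∷ z ∷ a ∷ [])
            (λ v x y z a → []
               ⊢ v ⊕ (x ⊕ x ⊕ x ⊖ y ⊖ z) ⊕ (z ⊕ z ⊖ (x ⊕ x)) ⊖ (x ⊕ x ⊖ a) ≐ v ⊖ (nil ⊖ (a ⊖ x ⊖ y ⊕ z))) refl)))
        (χ-cong (a - δ) (t + ε) u₁ v (deduce one (v ∷ x ∷ y ∷ z ∷ a ∷ [])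
            (λ v x y z a → []
               ⊢ v ⊕ (x ⊕ x ⊕ x ⊖ y ⊖ z) ⊕ (z ⊕ z ⊖ (x ⊕ x)) ⊖ (a ⊖ (y ⊕ y ⊖ (x ⊕ x))) ≐ v ⊖ (a ⊕ x ⊖ y ⊖ z)) refl)))
      z-last : c (t + δ + ε) ≡ (((c t xor χ (0ℤ - u₁) v) xor χ u₂ v) xor χ (0ℤ - u₄) v) xor χ u₃ v
      z-last = trans (shift-b (t + δ)) (cong₂ _xor_ (cong₂ _xor_
        (trans (shift-a t) (cong₂ _xor_ (cong (c t xor_)
          (χ-cong (x + x - a) t (0ℤ - u₁) v (deduce one (v ∷ x ∷ y ∷ z ∷ a ∷ [])
              (λ v x y z a → []
                 ⊢ v ⊕ (x ⊕ x ⊕ x ⊖ y ⊖ z) ⊖ (x ⊕ x ⊖ a) ≐ v ⊖ (nil ⊖ (a ⊕ x ⊖ y ⊖ z))) refl)))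
          (χ-cong (a - δ) t u₂ v (deduce one (v ∷ x ∷ y ∷ z ∷ a ∷ [])
              (λ v x y z a → []
                 ⊢ v ⊕ (x ⊕ x ⊕ x ⊖ y ⊖ z) ⊖ (a ⊖ (y ⊕ y ⊖ (x ⊕ x))) ≐ v ⊖ (a ⊖ x ⊖ y ⊕ z)) refl))))
        (χ-cong (x + x - b) (t + δ) (0ℤ - u₄) v (deduce one (v ∷ x ∷ y ∷ z ∷ b ∷ [])
            (λ v x y z b → []
               ⊢ v ⊕ (x ⊕ x ⊕ x ⊖ y ⊖ z) ⊕ (y ⊕ y ⊖ (x ⊕ x)) ⊖ (x ⊕ x ⊖ b) ≐ v ⊖ (nil ⊖ (b ⊖ x ⊕ y ⊖ z))) refl)))
        (χ-cong (b - ε) (t + δ) u₃ v (deduce one (v ∷ x ∷ y ∷ z ∷ b ∷ [])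
            (λ v x y z b → []
               ⊢ v ⊕ (x ⊕ x ⊕ x ⊖ y ⊖ z) ⊕ (y ⊕ y ⊖ (x ⊕ x)) ⊖ (b ⊖ (z ⊕ z ⊖ (x ⊕ x))) ≐ v ⊖ (b ⊕ x ⊖ y ⊖ z)) refl)))

  module _ {c x a y} (good : Good c x) (good-a : Good (c ⊞ a) y) (a≉x : a ≉ x) where

    -- If the centre stayed at `x`, the reflection about `x` would preserve both `c` and `c ⊞ a`,
    -- hence the single point `a` in which they differ. Comparing the colours of `a` and its mirror
    -- image shows this.
    toggled-centre≉centre : y ≉ x
    toggled-centre≉centre y≈x = true≢false (xor-injectiveʳ (c a) (begin
      c a xor true                          ≡⟨ cong (c a xor_) (χ-refl a) ⟨
      (c ⊞ a) a                             ≡⟨ symmetric good-a a ⟨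
      c (y + y - a) xor χ a (y + y - a)     ≡⟨ cong₂ _xor_ unmoved (χ-false apart) ⟩
      c a xor false                         ∎))
      where
      open ≡-Reasoning
      true≢false : true ≢ false
      true≢false ()
      unmoved : c (y + y - a) ≡ c a
      unmoved = trans (periodic good (deduce one (x ∷ y ∷ a ∷ [])
          (λ x y a → (+ 2 , y ≐ x) ∷ [] ⊢ y ⊕ y ⊖ a ≐ x ⊕ x ⊖ a) refl y≈x)) (symmetric good a)
      apart : y + y - a ≉ a
      apart e = a≉x (deduce two (x ∷ y ∷ a ∷ [])
          (λ x y a → (+ 2 , y ≐ x) ∷ (-1ℤ , y ⊕ y ⊖ a ≐ a) ∷ [] ⊢ a ≐ x) refl y≈x e)

    -- A reflection about `a` fixes the toggled point, so it would be a symmetry of `c` as well, and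
    -- uniqueness of the centre would give x ≈ y ≈ a.
    toggled-centre≉toggle : y ≉ a
    toggled-centre≉toggle y≈a = a≉x (deduce one (x ∷ y ∷ a ∷ [])
        (λ x y a → (-1ℤ , y ≐ a) ∷ (-1ℤ , x ≐ y) ∷ [] ⊢ a ≐ x) refl y≈a
      (centre-unique {c} {c} {x} {y} (λ _ → refl) good
        (record { periodic = periodic good ; symmetric = sym-y ; rotationFree = rotationFree good })))
      where
      sym-y : Symmetric y c
      sym-y v = xor-injectiveˡ (χ a v) (trans
        (cong (c (y + y - v) xor_) (sym (trans (χ-mirror a (y + y) v)
          (χ-cong (y + y - a) v a v (deduce one (y ∷ a ∷ v ∷ [])
              (λ y a v → (- + 2 , y ≐ a) ∷ [] ⊢ v ⊖ (y ⊕ y ⊖ a) ≐ v ⊖ a) refl y≈a)))))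
        (symmetric good-a v))

  module _ {c x a b y z} (good : Good c x) (good-a : Good (c ⊞ a) y) (good-b : Good (c ⊞ b) z)
    (a≉x : a ≉ x) (b≉x : b ≉ x) (a≉b : a ≉ b) where

    -- Two matchings with two signs each give eight cases. Four of them contradict the distinctness
    -- of `a`, `b` and `x`; the other four are the configurations sought.
    classify :
      (a + x - y - z ≈± b + x - y - z × a - x - y + z ≈± b - x + y - z) ⊎
      (a + x - y - z ≈± b - x + y - z × a - x - y + z ≈± b + x - y - z) →
      (Midpoint x a y × Midpoint x b z) ⊎ ∃ λ r → Related r x a b y z
    classify (inj₁ (same e , _)) =
      ⊥-elim (a≉b (deduce one (a ∷ b ∷ x ∷ y ∷ z ∷ [])
          (λ a b x y z → (1ℤ , a ⊕ x ⊖ y ⊖ z ≐ b ⊕ x ⊖ y ⊖ z) ∷ [] ⊢ a ≐ b) refl e))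
    classify (inj₁ (opposite e , same f)) = inj₁
      ( deduce two (a ∷ b ∷ x ∷ y ∷ z ∷ [])
          (λ a b x y z → (-1ℤ , a ⊕ x ⊖ y ⊖ z ≐ nil ⊖ (b ⊕ x ⊖ y ⊖ z)) ∷
             (-1ℤ , a ⊖ x ⊖ y ⊕ z ≐ b ⊖ x ⊕ y ⊖ z) ∷ []
             ⊢ y ⊕ y ≐ x ⊕ a) refl e f
      , deduce two (a ∷ b ∷ x ∷ y ∷ z ∷ [])
          (λ a b x y z → (-1ℤ , a ⊕ x ⊖ y ⊖ z ≐ nil ⊖ (b ⊕ x ⊖ y ⊖ z)) ∷
             (1ℤ , a ⊖ x ⊖ y ⊕ z ≐ b ⊖ x ⊕ y ⊖ z) ∷ []
             ⊢ z ⊕ z ≐ x ⊕ b) refl e f )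
    classify (inj₁ (opposite e , opposite f)) = inj₂ (mirrored , mirror
      (deduce one (a ∷ b ∷ x ∷ y ∷ z ∷ [])
          (λ a b x y z → (1ℤ , a ⊖ x ⊖ y ⊕ z ≐ nil ⊖ (b ⊖ x ⊕ y ⊖ z)) ∷ [] ⊢ a ⊕ b ≐ x ⊕ x) refl
            f)
      (deduce two (a ∷ b ∷ x ∷ y ∷ z ∷ [])
          (λ a b x y z → (-1ℤ , a ⊕ x ⊖ y ⊖ z ≐ nil ⊖ (b ⊕ x ⊖ y ⊖ z)) ∷
             (1ℤ , a ⊖ x ⊖ y ⊕ z ≐ nil ⊖ (b ⊖ x ⊕ y ⊖ z)) ∷ []
             ⊢ y ⊕ z ≐ x ⊕ x) refl e f))
    classify (inj₂ (same e , same f)) = inj₂ (stepped , step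
      (deduce one (a ∷ b ∷ x ∷ y ∷ z ∷ [])
          (λ a b x y z → (-1ℤ , a ⊕ x ⊖ y ⊖ z ≐ b ⊖ x ⊕ y ⊖ z) ∷ []
             ⊢ y ⊕ y ⊕ b ≐ x ⊕ x ⊕ a) refl e)
      (deduce one (a ∷ b ∷ x ∷ y ∷ z ∷ [])
          (λ a b x y z → (1ℤ , a ⊖ x ⊖ y ⊕ z ≐ b ⊕ x ⊖ y ⊖ z) ∷ [] ⊢ z ⊕ z ⊕ a ≐ x ⊕ x ⊕ b) refl
            f))
    classify (inj₂ (same e , opposite f)) =
      ⊥-elim (b≉x (deduce two (a ∷ b ∷ x ∷ y ∷ z ∷ [])
          (λ a b x y z → (-1ℤ , a ⊕ x ⊖ y ⊖ z ≐ b ⊖ x ⊕ y ⊖ z) ∷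
             (1ℤ , a ⊖ x ⊖ y ⊕ z ≐ nil ⊖ (b ⊕ x ⊖ y ⊖ z)) ∷ []
             ⊢ b ≐ x) refl e f))
    classify (inj₂ (opposite e , same f)) =
      ⊥-elim (a≉x (deduce two (a ∷ b ∷ x ∷ y ∷ z ∷ [])
          (λ a b x y z → (1ℤ , a ⊕ x ⊖ y ⊖ z ≐ nil ⊖ (b ⊖ x ⊕ y ⊖ z)) ∷
             (1ℤ , a ⊖ x ⊖ y ⊕ z ≐ b ⊕ x ⊖ y ⊖ z) ∷ []
             ⊢ a ≐ x) refl e f))
    classify (inj₂ (opposite e , opposite f)) = inj₂ (merged , merge
      (deduce one (a ∷ b ∷ x ∷ y ∷ z ∷ [])
          (λ a b x y z → (-1ℤ , a ⊖ x ⊖ y ⊕ z ≐ nil ⊖ (b ⊕ x ⊖ y ⊖ z)) ∷ []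
             ⊢ y ⊕ y ≐ a ⊕ b) refl f)
      (deduce one (a ∷ b ∷ x ∷ y ∷ z ∷ [])
          (λ a b x y z → (-1ℤ , a ⊕ x ⊖ y ⊖ z ≐ nil ⊖ (b ⊖ x ⊕ y ⊖ z)) ∷ []
             ⊢ z ⊕ z ≐ a ⊕ b) refl e))

    abstract
      -- Evaluating `evenly-covered` at each uᵢ provides its partner. The pair u₁, u₂ cannot be
      -- matched, because that puts z at x or y at a; likewise u₃, u₄ would put y at x or z at b.
      toggle-pair : (Midpoint x a y × Midpoint x b z) ⊎ ∃ λ r → Related r x a b y z
      toggle-pair = classify (pairing ≉₁₂ ≉₃₄
        (partner u₁ u₂ u₃ u₄ (even u₁))
        (partner u₂ u₁ u₃ u₄ (trans (xor-swap (χ± u₁ u₂) (χ± u₂ u₂) (χ± u₃ u₂) (χ± u₄ u₂)) (even u₂)))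
        (partner u₃ u₄ u₁ u₂ (trans (xor-exchange (χ± u₁ u₃) (χ± u₂ u₃) (χ± u₃ u₃) (χ± u₄ u₃)) (even u₃)))
        (partner u₄ u₃ u₁ u₂ (trans (xor-rotate (χ± u₁ u₄) (χ± u₂ u₄) (χ± u₃ u₄) (χ± u₄ u₄)) (even u₄))))
        where
        u₁ u₂ u₃ u₄ : ℤ
        u₁ = a + x - y - z
        u₂ = a - x - y + z
        u₃ = b + x - y - z
        u₄ = b - x + y - z
        even : ∀ v → χ± u₁ v xor (χ± u₂ v xor (χ± u₃ v xor χ± u₄ v)) ≡ false
        even = evenly-covered good good-a good-b
        ≉₁₂ : ¬ u₁ ≈± u₂
        ≉₁₂ (same e)     = toggled-centre≉centre good good-b b≉x (deduce two (a ∷ x ∷ y ∷ z ∷ [])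
            (λ a x y z → (-1ℤ , a ⊕ x ⊖ y ⊖ z ≐ a ⊖ x ⊖ y ⊕ z) ∷ [] ⊢ z ≐ x) refl e)
        ≉₁₂ (opposite e) = toggled-centre≉toggle good good-a a≉x (deduce two (a ∷ x ∷ y ∷ z ∷ [])
            (λ a x y z → (-1ℤ , a ⊕ x ⊖ y ⊖ z ≐ nil ⊖ (a ⊖ x ⊖ y ⊕ z)) ∷ [] ⊢ y ≐ a) refl e)
        ≉₃₄ : ¬ u₃ ≈± u₄
        ≉₃₄ (same e)     = toggled-centre≉centre good good-a a≉x (deduce two (b ∷ x ∷ y ∷ z ∷ [])
            (λ b x y z → (-1ℤ , b ⊕ x ⊖ y ⊖ z ≐ b ⊖ x ⊕ y ⊖ z) ∷ [] ⊢ y ≐ x) refl e)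
        ≉₃₄ (opposite e) = toggled-centre≉toggle good good-b b≉x (deduce two (b ∷ x ∷ y ∷ z ∷ [])
            (λ b x y z → (-1ℤ , b ⊕ x ⊖ y ⊖ z ≐ nil ⊖ (b ⊖ x ⊕ y ⊖ z)) ∷ [] ⊢ z ≐ b) refl e)

  related-sym : ∀ {r x a b y z} → Related r x a b y z → Related r x b a z y
  related-sym (mirror {x} {a} {b} {y} {z} e f) = mirror
    (deduce one (a ∷ b ∷ x ∷ [])
        (λ a b x → (1ℤ , a ⊕ b ≐ x ⊕ x) ∷ [] ⊢ b ⊕ a ≐ x ⊕ x) refl e) (deduce one (y ∷ z ∷ x ∷ [])
        (λ y z x → (1ℤ , y ⊕ z ≐ x ⊕ x) ∷ [] ⊢ z ⊕ y ≐ x ⊕ x) refl f)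
  related-sym (step e f) = step f e
  related-sym (merge {x} {a} {b} {y} {z} e f) = merge
    (deduce one (a ∷ b ∷ z ∷ [])
        (λ a b z → (1ℤ , z ⊕ z ≐ a ⊕ b) ∷ [] ⊢ z ⊕ z ≐ b ⊕ a) refl f) (deduce one (a ∷ b ∷ y ∷ [])
        (λ a b y → (1ℤ , y ⊕ y ≐ a ⊕ b) ∷ [] ⊢ y ⊕ y ≐ b ⊕ a) refl e)

  -- Each relation is linear and can be solved for `b`. Consequently a point has at most one link of
  -- each kind, which drives the case analysis in `triangle`.
  related-unique : ∀ {r x a b b′ y z z′} → Related r x a b y z → Related r x a b′ y z′ → b ≈ b′
  related-unique {x = x} {a} {b} {b′} (mirror e _) (mirror f _) =
    deduce one (x ∷ a ∷ b ∷ b′ ∷ [])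
        (λ x a b b′ → (1ℤ , a ⊕ b ≐ x ⊕ x) ∷ (-1ℤ , a ⊕ b′ ≐ x ⊕ x) ∷ [] ⊢ b ≐ b′) refl e f
  related-unique {x = x} {a} {b} {b′} {y} (step e _) (step f _) =
    deduce one (x ∷ a ∷ b ∷ b′ ∷ y ∷ [])
        (λ x a b b′ y → (1ℤ , y ⊕ y ⊕ b ≐ x ⊕ x ⊕ a) ∷ (-1ℤ , y ⊕ y ⊕ b′ ≐ x ⊕ x ⊕ a) ∷ []
           ⊢ b ≐ b′) refl e f
  related-unique {x = x} {a} {b} {b′} {y} (merge e _) (merge f _) =
    deduce one (a ∷ b ∷ b′ ∷ y ∷ [])
        (λ a b b′ y → (-1ℤ , y ⊕ y ≐ a ⊕ b) ∷ (1ℤ , y ⊕ y ≐ a ⊕ b′) ∷ [] ⊢ b ≐ b′) refl e f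

  -- A mirrored pair transports the midpoint condition by reflection. For the other two relations,
  -- the midpoint condition for `a` would put `b` at the centre.
  midpoint-spreads : ∀ {r x a b y z} → a ≉ x → b ≉ x → Related r x a b y z →
    Midpoint x a y → Midpoint x b z
  midpoint-spreads {x = x} {a} {b} {y} {z} a≉x b≉x (mirror e f) g =
    deduce one (x ∷ a ∷ b ∷ y ∷ z ∷ [])
        (λ x a b y z → (-1ℤ , a ⊕ b ≐ x ⊕ x) ∷ (+ 2 , y ⊕ z ≐ x ⊕ x) ∷ (-1ℤ , y ⊕ y ≐ x ⊕ a) ∷ []
           ⊢ z ⊕ z ≐ x ⊕ b) refl e f g
  midpoint-spreads {x = x} {a} {b} {y} a≉x b≉x (step e _) g =
    ⊥-elim (b≉x (deduce one (x ∷ a ∷ b ∷ y ∷ [])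
        (λ x a b y → (1ℤ , y ⊕ y ⊕ b ≐ x ⊕ x ⊕ a) ∷ (-1ℤ , y ⊕ y ≐ x ⊕ a) ∷ [] ⊢ b ≐ x) refl e g))
  midpoint-spreads {x = x} {a} {b} {y} a≉x b≉x (merge e _) g =
    ⊥-elim (b≉x (deduce one (x ∷ a ∷ b ∷ y ∷ [])
        (λ x a b y → (-1ℤ , y ⊕ y ≐ a ⊕ b) ∷ (1ℤ , y ⊕ y ≐ x ⊕ a) ∷ [] ⊢ b ≐ x) refl e g))

  -- Toggling four points

  toggled : (Fin 4 → ℤ) → Colouring → List (Fin 4) → Colouring
  toggled w = foldr (λ i c → c ⊞ w i)

  toggled-periodic : ∀ w {c} → Periodic c → ∀ S → Periodic (toggled w c S)
  toggled-periodic w     per []      = per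
  toggled-periodic w {c} per (i ∷ S) = ⊞-periodic {toggled w c S} (w i) (toggled-periodic w per S)

  toggled-off : ∀ w c S v → (∀ {i} → i ∈ˡ S → v ≉ w i) → toggled w c S v ≡ c v
  toggled-off w c []      v off = refl
  toggled-off w c (i ∷ S) v off = trans
    (cong₂ _xor_ (toggled-off w c S v (off ∘ there)) (χ-false (off (here refl)))) (xor-identityʳ (c v))

  -- The situation to be refuted. A list of toggles may repeat an index, which undoes the toggle.
  -- Length 3 suffices: `¬central` starts after at most one toggle, moves to a neighbour, and
  -- inspects the toggles available there.
  module Toggles (w : Fin 4 → ℤ) (w-injective : ∀ {i j} → i ≢ j → w i ≉ w j)
    (c₀ : Colouring) (centre : List (Fin 4) → ℤ)
    (good : ∀ S → length S ≤ 3 → Good (toggled w c₀ S) (centre S)) where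

    sum : ℤ
    sum = w 0F + w 1F + w 2F + w 3F

    -- A relabelling of the four indices, kept as the facts that case distinctions and linear
    -- arithmetic consume. Adjacent transpositions generate all the relabellings needed.
    record Enumeration (i j k l : Fin 4) : Set where
      field
        i≢j : i ≢ j
        i≢k : i ≢ k
        i≢l : i ≢ l
        j≢k : j ≢ k
        j≢l : j ≢ l
        k≢l : k ≢ l
        covers : ∀ m → m ≡ i ⊎ m ≡ j ⊎ m ≡ k ⊎ m ≡ l
        sums   : w i + w j + w k + w l ≈ sum

    open Enumeration

    swap-ij : ∀ {i j k l} → Enumeration i j k l → Enumeration j i k l
    swap-ij {i} {j} {k} {l} E = record
      { i≢j = i≢j E ∘ sym ; i≢k = j≢k E ; i≢l = j≢l E ; j≢k = i≢k E ; j≢l = i≢l E ; k≢l = k≢l E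
      ; covers = λ m → [ inj₂ ∘ inj₁ , [ inj₁ , inj₂ ∘ inj₂ ]′ ]′ (covers E m)
      ; sums = deduce one (w i ∷ w j ∷ w k ∷ w l ∷ sum ∷ [])
          (λ i j k l s → (1ℤ , i ⊕ j ⊕ k ⊕ l ≐ s) ∷ [] ⊢ j ⊕ i ⊕ k ⊕ l ≐ s) refl (sums E) }

    swap-jk : ∀ {i j k l} → Enumeration i j k l → Enumeration i k j l
    swap-jk {i} {j} {k} {l} E = record
      { i≢j = i≢k E ; i≢k = i≢j E ; i≢l = i≢l E ; j≢k = j≢k E ∘ sym ; j≢l = k≢l E ; k≢l = j≢l E
      ; covers = λ m → [ inj₁ , [ inj₂ ∘ inj₂ ∘ inj₁ , [ inj₂ ∘ inj₁ , inj₂ ∘ inj₂ ∘ inj₂ ]′ ]′ ]′ (covers E m)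
      ; sums = deduce one (w i ∷ w j ∷ w k ∷ w l ∷ sum ∷ [])
          (λ i j k l s → (1ℤ , i ⊕ j ⊕ k ⊕ l ≐ s) ∷ [] ⊢ i ⊕ k ⊕ j ⊕ l ≐ s) refl (sums E) }

    swap-kl : ∀ {i j k l} → Enumeration i j k l → Enumeration i j l k
    swap-kl {i} {j} {k} {l} E = record
      { i≢j = i≢j E ; i≢k = i≢l E ; i≢l = i≢k E ; j≢k = j≢l E ; j≢l = j≢k E ; k≢l = k≢l E ∘ sym
      ; covers = λ m → [ inj₁ , [ inj₂ ∘ inj₁ , [ inj₂ ∘ inj₂ ∘ inj₂ , inj₂ ∘ inj₂ ∘ inj₁ ]′ ]′ ]′ (covers E m)
      ; sums = deduce one (w i ∷ w j ∷ w k ∷ w l ∷ sum ∷ [])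
          (λ i j k l s → (1ℤ , i ⊕ j ⊕ k ⊕ l ≐ s) ∷ [] ⊢ i ⊕ j ⊕ l ⊕ k ≐ s) refl (sums E) }

    standard : Enumeration 0F 1F 2F 3F
    standard = record
      { i≢j = λ () ; i≢k = λ () ; i≢l = λ () ; j≢k = λ () ; j≢l = λ () ; k≢l = λ ()
      ; covers = λ { 0F → inj₁ refl ; 1F → inj₂ (inj₁ refl)
                   ; 2F → inj₂ (inj₂ (inj₁ refl)) ; 3F → inj₂ (inj₂ (inj₂ refl)) }
      ; sums = ≈-refl }

    enumeration-ending : ∀ l → ∃ λ i → ∃ λ j → ∃ λ k → Enumeration i j k l
    enumeration-ending 0F = 1F , 2F , 3F , swap-kl (swap-jk (swap-ij standard))
    enumeration-ending 1F = 0F , 2F , 3F , swap-kl (swap-jk standard)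
    enumeration-ending 2F = 0F , 1F , 3F , swap-kl standard
    enumeration-ending 3F = 0F , 1F , 2F , standard

    Free : List (Fin 4) → Fin 4 → Set
    Free S i = w i ≉ centre S

    Halving : List (Fin 4) → Fin 4 → Set
    Halving S i = Midpoint (centre S) (w i) (centre (i ∷ S))

    Linked : Relation → List (Fin 4) → Fin 4 → Fin 4 → Set
    Linked r S i j = Related r (centre S) (w i) (w j) (centre (i ∷ S)) (centre (j ∷ S))

    -- This occurs, for instance, when c is an arithmetic progression in ℤ/n that may
    -- be prolonged or shortened at its ends.
    record Triangle (S : List (Fin 4)) (l : Fin 4) : Set where
      field
        {i j k} : Fin 4
        enumeration : Enumeration i j k l
        ij : Linked mirrored S i j
        ik : Linked stepped S i k
        jk : Linked merged S j k

    record Central (S : List (Fin 4)) : Set where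
      field
        {l} : Fin 4
        triangle : Triangle S l
        at-centre : w l ≈ centre S

    record Balanced (S : List (Fin 4)) : Set where
      field
        {l} : Fin 4
        triangle : Triangle S l
        mean : centre S + centre S + centre S + centre S ≈ sum

    module _ (S : List (Fin 4)) (S≤2 : length S ≤ 2) where

      link : ∀ {i j} → i ≢ j → Free S i → Free S j →
        (Halving S i × Halving S j) ⊎ ∃ λ r → Linked r S i j
      link {i} {j} i≢j fi fj = toggle-pair (good S (ℕₚ.m≤n⇒m≤1+n S≤2)) (good (i ∷ S) (s≤s S≤2))
        (good (j ∷ S) (s≤s S≤2)) fi fj (w-injective i≢j)

      halving-spreads : ∀ {i j} → Free S i → Free S j → Halving S i → Halving S j
      halving-spreads {i} {j} fi fj h with i ≟ j
      ... | yes refl = h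
      ... | no i≢j with link i≢j fi fj
      ...   | inj₁ (_ , h′) = h′
      ...   | inj₂ (r , e)  = midpoint-spreads fi fj e h

      module _ {i₀} (free₀ : Free S i₀) (¬halving : ¬ Halving S i₀) where

        link′ : ∀ {i j} → i ≢ j → Free S i → Free S j → ∃ λ r → Linked r S i j
        link′ i≢j fi fj with link i≢j fi fj
        ... | inj₁ (h , _) = ⊥-elim (¬halving (halving-spreads fi free₀ h))
        ... | inj₂ e       = e

        clash : ∀ {r i j k} {A : Set} → j ≢ k → Linked r S i j → Linked r S i k → A
        clash j≢k e f = ⊥-elim (w-injective j≢k (related-unique e f))

        -- By `clash`, two links at a common point are of different kinds, so the three links form a
        -- proper edge colouring of a triangle with three colours. The six surviving cases differ
        -- only in the labelling of the vertices.
        triangle : ∀ {i j k l} → Enumeration i j k l → Free S i → Free S j → Free S k → Triangle S l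
        triangle {i} {j} {k} {l} E fi fj fk
          with link′ (i≢j E) fi fj | link′ (i≢k E) fi fk | link′ (j≢k E) fj fk
        ... | mirrored , e | mirrored , f | _            = clash (j≢k E) e f
        ... | stepped  , e | stepped  , f | _            = clash (j≢k E) e f
        ... | merged   , e | merged   , f | _            = clash (j≢k E) e f
        ... | mirrored , e | stepped  , f | merged   , g =
          record { enumeration = E ; ij = e ; ik = f ; jk = g }
        ... | mirrored , e | stepped  , f | mirrored , g =
          clash (i≢k E) (related-sym e) g
        ... | mirrored , e | stepped  , f | stepped  , g =
          clash (i≢j E) (related-sym f) (related-sym g)
        ... | mirrored , e | merged   , f | stepped  , g =
          record { enumeration = swap-ij E ; ij = related-sym e ; ik = g ; jk = f }
        ... | mirrored , e | merged   , f | mirrored , g =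
          clash (i≢k E) (related-sym e) g
        ... | mirrored , e | merged   , f | merged   , g =
          clash (i≢j E) (related-sym f) (related-sym g)
        ... | stepped  , e | mirrored , f | merged   , g =
          record { enumeration = swap-jk E ; ij = f ; ik = e ; jk = related-sym g }
        ... | stepped  , e | mirrored , f | stepped  , g =
          clash (i≢k E) (related-sym e) g
        ... | stepped  , e | mirrored , f | mirrored , g =
          clash (i≢j E) (related-sym f) (related-sym g)
        ... | stepped  , e | merged   , f | mirrored , g =
          record { enumeration = swap-jk (swap-ij E) ; ij = g ; ik = related-sym e
                 ; jk = related-sym f }
        ... | stepped  , e | merged   , f | stepped  , g =
          clash (i≢k E) (related-sym e) g
        ... | stepped  , e | merged   , f | merged   , g =
          clash (i≢j E) (related-sym f) (related-sym g)
        ... | merged   , e | mirrored , f | stepped  , g =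
          record { enumeration = swap-ij (swap-jk E) ; ij = related-sym f
                 ; ik = related-sym g ; jk = e }
        ... | merged   , e | mirrored , f | merged   , g =
          clash (i≢k E) (related-sym e) g
        ... | merged   , e | mirrored , f | mirrored , g =
          clash (i≢j E) (related-sym f) (related-sym g)
        ... | merged   , e | stepped  , f | mirrored , g =
          record { enumeration = swap-ij (swap-jk (swap-ij E)) ; ij = related-sym g
                 ; ik = related-sym f ; jk = related-sym e }
        ... | merged   , e | stepped  , f | merged   , g =
          clash (i≢k E) (related-sym e) g
        ... | merged   , e | stepped  , f | stepped  , g =
          clash (i≢j E) (related-sym f) (related-sym g)

        -- The point `w k` already has a stepped link to `w i` and a merged one to `w j`, so its
        -- link to `w l` is mirrored. The four points thus form two pairs symmetric about the
        -- centre.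
        balanced : (∀ i → Free S i) → ∀ {l} → Triangle S l → Balanced S
        balanced free {l} T = record { triangle = T ; mean = mean }
          where
          open Triangle T
          E = enumeration
          x = centre S
          reflected : ∀ {a b y z} → Related mirrored x a b y z → a + b ≈ x + x
          reflected (mirror e _) = e
          kl : Linked mirrored S k l
          kl with link′ (k≢l E) (free k) (free l)
          ... | mirrored , g = g
          ... | stepped  , g = clash (i≢l E) (related-sym ik) g
          ... | merged   , g = clash (j≢l E) (related-sym jk) g
          mean : x + x + x + x ≈ sum
          mean = deduce one (x ∷ w i ∷ w j ∷ w k ∷ w l ∷ sum ∷ [])
              (λ x i j k l s → (-1ℤ , i ⊕ j ≐ x ⊕ x) ∷ (-1ℤ , k ⊕ l ≐ x ⊕ x) ∷
                 (1ℤ , i ⊕ j ⊕ k ⊕ l ≐ s) ∷ []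
                 ⊢ x ⊕ x ⊕ x ⊕ x ≐ s) refl
            (reflected ij) (reflected kl) (sums E)

      halving? : ∀ i → Dec (Halving S i)
      halving? i = centre (i ∷ S) + centre (i ∷ S) ≈? centre S + w i

      -- At most one point lies at the centre, so three free points are always available. If one of
      -- them is halving, all free points are; otherwise the three form a triangle, and the fourth
      -- point is either at the centre or free.
      classification : (∀ i → Free S i → Halving S i) ⊎ Central S ⊎ Balanced S
      classification with any? (λ l → w l ≈? centre S)
      ... | yes (l , at-centre) with i , j , k , E ← enumeration-ending l = result (halving? i)
        where
        free : ∀ {m} → m ≢ l → Free S m
        free {m} m≢l e = w-injective m≢l (deduce one (w m ∷ w l ∷ centre S ∷ [])
            (λ m l x → (1ℤ , m ≐ x) ∷ (-1ℤ , l ≐ x) ∷ [] ⊢ m ≐ l) refl e at-centre)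
        result : Dec (Halving S i) → _
        result (yes h) = inj₁ (λ m fm → halving-spreads (free (i≢l E)) fm h)
        result (no ¬h) = inj₂ (inj₁ (record
          { triangle = triangle (free (i≢l E)) ¬h E (free (i≢l E)) (free (j≢l E)) (free (k≢l E))
          ; at-centre = at-centre }))
      ... | no none = result (halving? 0F)
        where
        free : ∀ m → Free S m
        free m e = none (m , e)
        result : Dec (Halving S 0F) → _
        result (yes h) = inj₁ (λ m fm → halving-spreads (free 0F) fm h)
        result (no ¬h) = inj₂ (inj₂ (balanced (free 0F) ¬h free
          (triangle (free 0F) ¬h standard (free 0F) (free 1F) (free 2F))))

    -- A repeated toggle restores the colouring, and a colouring determines its centre.
    back : ∀ S i → length S ≤ 1 → centre (i ∷ i ∷ S) ≈ centre S
    back S i S≤1 = centre-unique {c′ = toggled w c₀ S}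
      (λ v → trans (xor-assoc (toggled w c₀ S v) _ _)
        (trans (cong (toggled w c₀ S v xor_) (xor-same (χ (w i) v))) (xor-identityʳ _)))
      (good (i ∷ i ∷ S) (s≤s (s≤s S≤1))) (good S (ℕₚ.≤-trans S≤1 (s≤s z≤n)))

    -- In coordinates with x = 0 and w i = p, the points are 0, p, −p and w k; the
    -- neighbours force w k to be 2p or 3p, and both are then excluded.
    ¬central : ∀ S → length S ≤ 1 → ¬ Central S
    ¬central S S≤1 record
      { l = l ; at-centre = at-l
      ; triangle = record { i = i ; j = j ; k = k ; enumeration = E
        ; ij = mirror ij-x _ ; ik = step p-ik _ ; jk = merge q-jk r-jk } } =
      [ threefold , twofold ]′ toggled-j
      where
      x p q r : ℤ
      x = centre S
      p = centre (i ∷ S)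
      q = centre (j ∷ S)
      r = centre (k ∷ S)

      i≉x : w i ≉ x
      i≉x e = w-injective (i≢l E) (deduce one (w i ∷ w l ∷ x ∷ [])
          (λ i l x → (1ℤ , i ≐ x) ∷ (-1ℤ , l ≐ x) ∷ [] ⊢ i ≐ l) refl e at-l)

      -- Take `x` as origin; then `q` is the midpoint of -w i and `w k`. A halving edge back to 0
      -- gives w k = 3 w i. A point at `q` can only be `w i`, with the same result. If `q` is the
      -- mean of the points, then w k = 2 w i.
      toggled-j : (w k + x + x ≈ w i + w i + w i) ⊎ (w k + x ≈ w i + w i)
      toggled-j with classification (j ∷ S) (s≤s S≤1)
      ... | inj₁ halving = inj₁ (deduce one (centre (j ∷ j ∷ S) ∷ x ∷ q ∷ w i ∷ w j ∷ w k ∷ [])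
          (λ y x q i j k → (- + 2 , y ⊕ y ≐ q ⊕ j) ∷ (+ 4 , y ≐ x) ∷ (- + 3 , i ⊕ j ≐ x ⊕ x) ∷
             (-1ℤ , q ⊕ q ≐ j ⊕ k) ∷ []
             ⊢ k ⊕ x ⊕ x ≐ i ⊕ i ⊕ i) refl
              (halving j free) (back S j S≤1) ij-x q-jk)
        where
        free : w j ≉ q
        free e = w-injective (j≢k E) (deduce one (w j ∷ w k ∷ q ∷ [])
            (λ j k q → (+ 2 , j ≐ q) ∷ (1ℤ , q ⊕ q ≐ j ⊕ k) ∷ [] ⊢ j ≐ k) refl e q-jk)
      ... | inj₂ (inj₂ b) = inj₂ (deduce one (x ∷ q ∷ w i ∷ w j ∷ w k ∷ w l ∷ sum ∷ [])
          (λ x q i j k l s → (1ℤ , q ⊕ q ⊕ q ⊕ q ≐ s) ∷ (-1ℤ , i ⊕ j ⊕ k ⊕ l ≐ s) ∷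
             (1ℤ , l ≐ x) ∷ (- + 2 , q ⊕ q ≐ j ⊕ k) ∷ (-1ℤ , i ⊕ j ≐ x ⊕ x) ∷ []
             ⊢ k ⊕ x ≐ i ⊕ i) refl
              (Balanced.mean b) (sums E) at-l q-jk ij-x)
      ... | inj₂ (inj₁ t) = at-q (covers E (Central.l t)) (Central.at-centre t)
        where
        at-q : ∀ {m} → m ≡ i ⊎ m ≡ j ⊎ m ≡ k ⊎ m ≡ l → w m ≈ q → _
        at-q (inj₁ refl) e = inj₁ (deduce one (x ∷ q ∷ w i ∷ w j ∷ w k ∷ [])
            (λ x q i j k → (- + 2 , i ≐ q) ∷ (-1ℤ , q ⊕ q ≐ j ⊕ k) ∷ (-1ℤ , i ⊕ j ≐ x ⊕ x) ∷ []
               ⊢ k ⊕ x ⊕ x ≐ i ⊕ i ⊕ i) refl e q-jk ij-x)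
        at-q (inj₂ (inj₁ refl)) e =
          ⊥-elim (w-injective (j≢k E) (deduce one (w j ∷ w k ∷ q ∷ [])
              (λ j k q → (+ 2 , j ≐ q) ∷ (1ℤ , q ⊕ q ≐ j ⊕ k) ∷ [] ⊢ j ≐ k) refl e q-jk))
        at-q (inj₂ (inj₂ (inj₁ refl))) e =
          ⊥-elim (w-injective (j≢k E) (deduce one (w j ∷ w k ∷ q ∷ [])
              (λ j k q → (- + 2 , k ≐ q) ∷ (-1ℤ , q ⊕ q ≐ j ⊕ k) ∷ [] ⊢ j ≐ k) refl e q-jk))
        at-q (inj₂ (inj₂ (inj₂ refl))) e =
          ⊥-elim (w-injective (i≢k E) (deduce one (x ∷ q ∷ w i ∷ w j ∷ w k ∷ w l ∷ [])
              (λ x q i j k l → (+ 2 , l ≐ q) ∷ (- + 2 , l ≐ x) ∷ (1ℤ , q ⊕ q ≐ j ⊕ k) ∷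
                 (1ℤ , i ⊕ j ≐ x ⊕ x) ∷ []
                 ⊢ i ≐ k) refl e at-l q-jk ij-x))

      -- With `x` as origin, the stepped link gives 2p = -w i. Each outcome of the classification at
      -- `p` then makes 1, 3, 4 or 5 times `w i` vanish.
      twofold : ¬ w k + x ≈ w i + w i
      twofold k≈2i with classification (i ∷ S) (s≤s S≤1)
      ... | inj₁ halving = i≉x (deduce one (centre (i ∷ i ∷ S) ∷ x ∷ p ∷ w i ∷ w k ∷ [])
          (λ y x p i k → (- + 2 , y ⊕ y ≐ p ⊕ i) ∷ (+ 4 , y ≐ x) ∷
             (-1ℤ , p ⊕ p ⊕ k ≐ x ⊕ x ⊕ i) ∷ (1ℤ , k ⊕ x ≐ i ⊕ i) ∷ []
             ⊢ i ≐ x) refl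
              (halving i free) (back S i S≤1) p-ik k≈2i)
        where
        free : w i ≉ p
        free e = i≉x (deduce three (x ∷ p ∷ w i ∷ w k ∷ [])
            (λ x p i k → (+ 2 , i ≐ p) ∷ (1ℤ , p ⊕ p ⊕ k ≐ x ⊕ x ⊕ i) ∷ (-1ℤ , k ⊕ x ≐ i ⊕ i) ∷ []
               ⊢ i ≐ x) refl e p-ik k≈2i)
      ... | inj₂ (inj₂ b) = i≉x (deduce four (x ∷ p ∷ w i ∷ w j ∷ w k ∷ w l ∷ sum ∷ [])
          (λ x p i j k l s → (-1ℤ , p ⊕ p ⊕ p ⊕ p ≐ s) ∷ (1ℤ , i ⊕ j ⊕ k ⊕ l ≐ s) ∷
             (-1ℤ , l ≐ x) ∷ (+ 2 , p ⊕ p ⊕ k ≐ x ⊕ x ⊕ i) ∷ (-1ℤ , i ⊕ j ≐ x ⊕ x) ∷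
             (- + 3 , k ⊕ x ≐ i ⊕ i) ∷ []
             ⊢ i ≐ x) refl
              (Balanced.mean b) (sums E) at-l p-ik ij-x k≈2i)
      ... | inj₂ (inj₁ t) = i≉x (at-p (covers E (Central.l t)) (Central.at-centre t))
        where
        at-p : ∀ {m} → m ≡ i ⊎ m ≡ j ⊎ m ≡ k ⊎ m ≡ l → w m ≈ p → w i ≈ x
        at-p (inj₁ refl) e = deduce three (x ∷ p ∷ w i ∷ w k ∷ [])
            (λ x p i k → (+ 2 , i ≐ p) ∷ (1ℤ , p ⊕ p ⊕ k ≐ x ⊕ x ⊕ i) ∷ (-1ℤ , k ⊕ x ≐ i ⊕ i) ∷ []
               ⊢ i ≐ x) refl e p-ik k≈2i
        at-p (inj₂ (inj₁ refl)) e =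
          deduce one (x ∷ p ∷ w i ∷ w j ∷ w k ∷ [])
              (λ x p i j k → (- + 2 , j ≐ p) ∷ (+ 2 , i ⊕ j ≐ x ⊕ x) ∷
                 (-1ℤ , p ⊕ p ⊕ k ≐ x ⊕ x ⊕ i) ∷ (1ℤ , k ⊕ x ≐ i ⊕ i) ∷ []
                 ⊢ i ≐ x) refl e ij-x p-ik k≈2i
        at-p (inj₂ (inj₂ (inj₁ refl))) e =
          deduce five (x ∷ p ∷ w i ∷ w k ∷ [])
              (λ x p i k → (+ 2 , k ≐ p) ∷ (1ℤ , p ⊕ p ⊕ k ≐ x ⊕ x ⊕ i) ∷
                 (- + 3 , k ⊕ x ≐ i ⊕ i) ∷ []
                 ⊢ i ≐ x) refl e p-ik k≈2i
        at-p (inj₂ (inj₂ (inj₂ refl))) e =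
          deduce one (x ∷ p ∷ w i ∷ w k ∷ w l ∷ [])
              (λ x p i k l → (+ 2 , l ≐ p) ∷ (- + 2 , l ≐ x) ∷ (1ℤ , p ⊕ p ⊕ k ≐ x ⊕ x ⊕ i) ∷
                 (-1ℤ , k ⊕ x ≐ i ⊕ i) ∷ []
                 ⊢ i ≐ x) refl e at-l p-ik k≈2i

      -- Toggling `w k` now moves the centre exactly onto `w i`. The classification there again
      -- leaves a small multiple of the distance from `x` to `w i` that must vanish.
      threefold : ¬ w k + x + x ≈ w i + w i + w i
      threefold k≈3i = contradict (classification (k ∷ S) (s≤s S≤1))
        where
        r≈i : r ≈ w i
        r≈i = deduce two (x ∷ r ∷ w i ∷ w j ∷ w k ∷ [])
            (λ x r i j k → (1ℤ , r ⊕ r ≐ j ⊕ k) ∷ (1ℤ , i ⊕ j ≐ x ⊕ x) ∷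
               (1ℤ , k ⊕ x ⊕ x ≐ i ⊕ i ⊕ i) ∷ []
               ⊢ r ≐ i) refl r-jk ij-x k≈3i
        k≉r : w k ≉ r
        k≉r e = w-injective (i≢k E) (deduce one (r ∷ w i ∷ w k ∷ [])
            (λ r i k → (-1ℤ , k ≐ r) ∷ (-1ℤ , r ≐ i) ∷ [] ⊢ i ≐ k) refl e r≈i)
        contradict : (∀ m → Free (k ∷ S) m → Halving (k ∷ S) m) ⊎ Central (k ∷ S) ⊎ Balanced (k ∷ S) → ⊥
        contradict (inj₁ halving) = i≉x (deduce four (centre (k ∷ k ∷ S) ∷ x ∷ r ∷ w i ∷ w k ∷ [])
            (λ y x r i k → (-1ℤ , y ⊕ y ≐ r ⊕ k) ∷ (+ 2 , y ≐ x) ∷ (-1ℤ , r ≐ i) ∷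
               (-1ℤ , k ⊕ x ⊕ x ≐ i ⊕ i ⊕ i) ∷ []
               ⊢ i ≐ x) refl
          (halving k k≉r) (back S k S≤1) r≈i k≈3i)
        contradict (inj₂ (inj₂ b)) = i≉x (deduce one (x ∷ r ∷ w i ∷ w j ∷ w k ∷ w l ∷ sum ∷ [])
            (λ x r i j k l s → (1ℤ , r ⊕ r ⊕ r ⊕ r ≐ s) ∷ (-1ℤ , i ⊕ j ⊕ k ⊕ l ≐ s) ∷
               (1ℤ , l ≐ x) ∷ (- + 4 , r ≐ i) ∷ (1ℤ , i ⊕ j ≐ x ⊕ x) ∷
               (1ℤ , k ⊕ x ⊕ x ≐ i ⊕ i ⊕ i) ∷ []
               ⊢ i ≐ x) refl
          (Balanced.mean b) (sums E) at-l r≈i ij-x k≈3i)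
        contradict (inj₂ (inj₁ record
          { l = l′ ; at-centre = at-l′
          ; triangle = record { i = i′ ; j = j′ ; k = k′ ; enumeration = E′
            ; ij = mirror i′j′-r _ ; ik = step p′-ik _ ; jk = merge q′-jk _ } })) =
          i≉x (locate (covers E′ k))
          where
          -- With `x` as origin the four points sum to 3 w i. The new triangle accounts for 3r = 3 w
          -- i through `l′`, `i′` and `j′`, so nothing is left for `k′`.
          k′≈x : w k′ ≈ x
          k′≈x = deduce one (x ∷ r ∷ w i ∷ w j ∷ w k ∷ w l ∷ w i′ ∷ w j′ ∷ w k′ ∷ w l′ ∷ sum ∷ [])
              (λ x r i j k l i′ j′ k′ l′ s → (-1ℤ , i ⊕ j ⊕ k ⊕ l ≐ s) ∷
                 (1ℤ , i′ ⊕ j′ ⊕ k′ ⊕ l′ ≐ s) ∷ (1ℤ , l ≐ x) ∷ (1ℤ , i ⊕ j ≐ x ⊕ x) ∷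
                 (-1ℤ , l′ ≐ r) ∷ (-1ℤ , i′ ⊕ j′ ≐ r ⊕ r) ∷ (- + 3 , r ≐ i) ∷
                 (1ℤ , k ⊕ x ⊕ x ≐ i ⊕ i ⊕ i) ∷ []
                 ⊢ k′ ≐ x) refl
            (sums E) (sums E′) at-l ij-x at-l′ i′j′-r r≈i k≈3i
          -- The point `w k` has one of the four roles in the new triangle. In the first two, its
          -- link describes toggling `k` a second time, which returns the centre to `x`.
          locate : k ≡ i′ ⊎ k ≡ j′ ⊎ k ≡ k′ ⊎ k ≡ l′ → w i ≈ x
          locate (inj₁ refl) =
            deduce five (centre (k ∷ k ∷ S) ∷ x ∷ r ∷ w i ∷ w k ∷ w k′ ∷ [])
                (λ y x r i k k′ → (-1ℤ , y ⊕ y ⊕ k′ ≐ r ⊕ r ⊕ k) ∷ (+ 2 , y ≐ x) ∷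
                   (1ℤ , k′ ≐ x) ∷ (- + 2 , r ≐ i) ∷ (-1ℤ , k ⊕ x ⊕ x ≐ i ⊕ i ⊕ i) ∷ []
                   ⊢ i ≐ x) refl
              p′-ik (back S k S≤1) k′≈x r≈i k≈3i
          locate (inj₂ (inj₁ refl)) =
            deduce three (centre (k ∷ k ∷ S) ∷ x ∷ w i ∷ w k ∷ w k′ ∷ [])
                (λ y x i k k′ → (-1ℤ , y ⊕ y ≐ k ⊕ k′) ∷ (+ 2 , y ≐ x) ∷ (-1ℤ , k′ ≐ x) ∷
                   (-1ℤ , k ⊕ x ⊕ x ≐ i ⊕ i ⊕ i) ∷ []
                   ⊢ i ≐ x) refl
              q′-jk (back S k S≤1) k′≈x k≈3i
          locate (inj₂ (inj₂ (inj₁ refl))) = deduce three (x ∷ w i ∷ w k ∷ [])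
              (λ x i k → (1ℤ , k ≐ x) ∷ (-1ℤ , k ⊕ x ⊕ x ≐ i ⊕ i ⊕ i) ∷ [] ⊢ i ≐ x) refl k′≈x k≈3i
          locate (inj₂ (inj₂ (inj₂ refl))) = ⊥-elim (k≉r at-l′)

    -- With `x` as origin, `halves` gives p = -w i and r = -w k. The stepped link then says both w k
    -- = 3 w i and w i = 3 w k, so four times their difference vanishes.
    ¬balanced : ¬ Balanced []
    ¬balanced record { mean = mean ; triangle = record { i = i ; j = j ; k = k ; enumeration = E
      ; ij = mirror ij-x _ ; ik = step p-ik r-ik } } =
      i≉k (deduce four (x ∷ p ∷ r ∷ w i ∷ w k ∷ [])
          (λ x p r i k → (- + 2 , x ⊕ x ≐ p ⊕ i) ∷ (+ 2 , x ⊕ x ≐ r ⊕ k) ∷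
             (-1ℤ , p ⊕ p ⊕ k ≐ x ⊕ x ⊕ i) ∷ (1ℤ , r ⊕ r ⊕ i ≐ x ⊕ x ⊕ k) ∷ []
             ⊢ i ≐ k) refl
        (halves i i-free p≉x) (halves k k-free r≉x) p-ik r-ik)
      where
      x p r : ℤ
      x = centre []
      p = centre (i ∷ [])
      r = centre (k ∷ [])
      i≉k : w i ≉ w k
      i≉k = w-injective (i≢k E)
      p≉x : p ≉ x
      p≉x e = i≉k (deduce one (x ∷ p ∷ w i ∷ w k ∷ [])
          (λ x p i k → (+ 2 , p ≐ x) ∷ (-1ℤ , p ⊕ p ⊕ k ≐ x ⊕ x ⊕ i) ∷ [] ⊢ i ≐ k) refl e p-ik)
      r≉x : r ≉ x
      r≉x e = i≉k (deduce one (x ∷ r ∷ w i ∷ w k ∷ [])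
          (λ x r i k → (- + 2 , r ≐ x) ∷ (1ℤ , r ⊕ r ⊕ i ≐ x ⊕ x ⊕ k) ∷ [] ⊢ i ≐ k) refl e r-ik)
      i-free : w i ≉ p
      i-free e = w-injective (j≢k E) (deduce one (x ∷ p ∷ w i ∷ w j ∷ w k ∷ [])
          (λ x p i j k → (- + 2 , i ≐ p) ∷ (-1ℤ , p ⊕ p ⊕ k ≐ x ⊕ x ⊕ i) ∷
             (1ℤ , i ⊕ j ≐ x ⊕ x) ∷ []
             ⊢ j ≐ k) refl e p-ik ij-x)
      k-free : w k ≉ r
      k-free e = w-injective (j≢k E) (deduce one (x ∷ r ∷ w i ∷ w j ∷ w k ∷ [])
          (λ x r i j k → (- + 2 , k ≐ r) ∷ (-1ℤ , r ⊕ r ⊕ i ≐ x ⊕ x ⊕ k) ∷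
             (1ℤ , i ⊕ j ≐ x ⊕ x) ∷ []
             ⊢ j ≐ k) refl e r-ik ij-x)
      -- After the toggle the centre has moved, so it is no longer the mean of the four points, and
      -- `¬central` excludes the central case. The halving case remains, and toggling `m` again
      -- leads back to `x`.
      halves : ∀ m → w m ≉ centre (m ∷ []) → centre (m ∷ []) ≉ x → x + x ≈ centre (m ∷ []) + w m
      halves m free moved with classification (m ∷ []) (s≤s z≤n)
      ... | inj₁ halving  = deduce one (x ∷ centre (m ∷ []) ∷ centre (m ∷ m ∷ []) ∷ w m ∷ [])
          (λ x z y m → (1ℤ , y ⊕ y ≐ z ⊕ m) ∷ (- + 2 , y ≐ x) ∷ [] ⊢ x ⊕ x ≐ z ⊕ m) refl
            (halving m free) (back [] m z≤n)
      ... | inj₂ (inj₁ t) = ⊥-elim (¬central _ (s≤s z≤n) t)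
      ... | inj₂ (inj₂ b) = ⊥-elim (moved (deduce four (x ∷ centre (m ∷ []) ∷ sum ∷ [])
          (λ x z s → (1ℤ , z ⊕ z ⊕ z ⊕ z ≐ s) ∷ (-1ℤ , x ⊕ x ⊕ x ⊕ x ≐ s) ∷ [] ⊢ z ≐ x) refl
            (Balanced.mean b) mean))

    -- Toggling twice along a halving edge would quarter the distance to w i
    -- although it returns to the starting point.
    halving⇒mean : (∀ i → Free [] i → Halving [] i) → ∀ i → Free [] i →
      let y = centre (i ∷ []) in y + y + y + y ≈ sum
    halving⇒mean halving i free with classification (i ∷ []) (s≤s z≤n)
    ... | inj₂ (inj₁ t) = ⊥-elim (¬central _ (s≤s z≤n) t)
    ... | inj₂ (inj₂ b) = Balanced.mean b
    ... | inj₁ halving′ = ⊥-elim (free (deduce three (centre [] ∷ centre (i ∷ []) ∷ centre (i ∷ i ∷ []) ∷ w i ∷ [])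
        (λ x y z i → (-1ℤ , y ⊕ y ≐ x ⊕ i) ∷ (- + 2 , z ⊕ z ≐ y ⊕ i) ∷ (+ 4 , z ≐ x) ∷ []
           ⊢ i ≐ x) refl
            (halving i free) (halving′ i free′) (back [] i z≤n)))
      where
      free′ : Free (i ∷ []) i
      free′ e = free (deduce one (centre [] ∷ centre (i ∷ []) ∷ w i ∷ [])
          (λ x y i → (+ 2 , i ≐ y) ∷ (1ℤ , y ⊕ y ≐ x ⊕ i) ∷ [] ⊢ i ≐ x) refl e (halving i free))

    -- By `halving⇒mean` every free toggle moves the centre to the mean of the four points, yet a
    -- halving edge recovers the toggled point from the new centre. Two free points would coincide,
    -- and at least two exist because at most one lies at the centre.
    ¬halving : ¬ (∀ i → Free [] i → Halving [] i)
    ¬halving halving = two-free (w 0F ≈? x) (w 1F ≈? x)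
      where
      x : ℤ
      x = centre []
      distinct : ∀ {i j} → i ≢ j → Free [] i → Free [] j → ⊥
      distinct {i} {j} i≢j fi fj = w-injective i≢j
        (deduce two (x ∷ centre (i ∷ []) ∷ centre (j ∷ []) ∷ w i ∷ w j ∷ sum ∷ [])
            (λ x y z i j s → (- + 2 , y ⊕ y ≐ x ⊕ i) ∷ (+ 2 , z ⊕ z ≐ x ⊕ j) ∷
               (1ℤ , y ⊕ y ⊕ y ⊕ y ≐ s) ∷ (-1ℤ , z ⊕ z ⊕ z ⊕ z ≐ s) ∷ []
               ⊢ i ≐ j) refl
          (halving i fi) (halving j fj) (halving⇒mean halving i fi) (halving⇒mean halving j fj))
      free : ∀ {i j} → i ≢ j → w i ≈ x → Free [] j
      free {i} {j} i≢j e f = w-injective i≢j (deduce one (x ∷ w i ∷ w j ∷ [])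
          (λ x i j → (1ℤ , i ≐ x) ∷ (-1ℤ , j ≐ x) ∷ [] ⊢ i ≐ j) refl e f)
      two-free : Dec (w 0F ≈ x) → Dec (w 1F ≈ x) → ⊥
      two-free (yes e) _       = distinct {1F} {2F} (λ ()) (free (λ ()) e) (free (λ ()) e)
      two-free (no f₀) (yes e) = distinct {0F} {2F} (λ ()) f₀ (free (λ ()) e)
      two-free (no f₀) (no f₁) = distinct {0F} {1F} (λ ()) f₀ f₁

    impossible : ⊥
    impossible with classification [] z≤n
    ... | inj₁ halving  = ¬halving halving
    ... | inj₂ (inj₁ t) = ¬central [] z≤n t
    ... | inj₂ (inj₂ b) = ¬balanced b

  -- Uniqueness of the rotation-invariant colouring

  multiple-invariant : ∀ {c α} → Periodic c → Invariant α c → ∀ k → Invariant (+ k * α) c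
  multiple-invariant {c} {α} per inv ℕ.zero v =
    per (subst (λ i → v + i ≈ v) (sym (ℤₚ.*-zeroˡ α)) (deduce one (v ∷ [])
        (λ v → [] ⊢ v ⊕ nil ≐ v) refl))
  multiple-invariant {c} {α} per inv (ℕ.suc k) v = trans
    (per (subst (λ i → v + i ≈ v + + k * α + α) (sym (ℤₚ.suc-* (+ k) α)) (deduce one (v ∷ α ∷ + k * α ∷ [])
        (λ v a b → [] ⊢ v ⊕ (a ⊕ b) ≐ v ⊕ b ⊕ a) refl)))
    (trans (inv (v + + k * α)) (multiple-invariant per inv k v))

  module _ {α} (α≉0 : α ≉ 0ℤ) where

    small-multiple : ∀ {k} → 1 ≤ k → k ≤ 4 → + k * α ≉ 0ℤ
    small-multiple {k} 1≤k k≤4 e = α≉0 (congruent (Cancellable.cancel (cancellable-≤4 1≤k k≤4) (α - 0ℤ)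
      (subst (+ n ∣ᶻ_) (regroup (+ k) α) (_≈_.divisibility e))))
      where
      regroup : ∀ k α → k * α - 0ℤ ≡ k * (α - 0ℤ)
      regroup = solve-∀
      cancellable-≤4 : ∀ {k} → 1 ≤ k → k ≤ 4 → Cancellable (+ k)
      cancellable-≤4 {1} _ _ = one
      cancellable-≤4 {2} _ _ = two
      cancellable-≤4 {3} _ _ = three
      cancellable-≤4 {4} _ _ = four
      cancellable-≤4 {ℕ.suc (ℕ.suc (ℕ.suc (ℕ.suc (ℕ.suc _))))} _ (s≤s (s≤s (s≤s (s≤s ()))))

    -- Five successive multiples of `α` are pairwise incongruent: their indices differ by 1, 2, 3 or
    -- 4, all of which can be cancelled. Five is one more than the number of points, as the
    -- pigeonhole arguments below require.
    gap : ∀ {s t : Fin 5} → s Fin.< t → ∃ λ k → + toℕ t * α ≡ + toℕ s * α + + k * α × + k * α ≉ 0ℤ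
    gap {s} {t} s<t = toℕ t ∸ toℕ s , split ,
      small-multiple (ℕₚ.m<n⇒0<n∸m s<t) (ℕₚ.≤-trans (ℕₚ.m∸n≤m (toℕ t) (toℕ s)) (ℕₚ.≤-pred (toℕ<n t)))
      where
      open ≡-Reasoning
      split : + toℕ t * α ≡ + toℕ s * α + + (toℕ t ∸ toℕ s) * α
      split = begin
        + toℕ t * α                                ≡⟨ cong (λ k → + k * α) (ℕₚ.m+[n∸m]≡n (ℕₚ.<⇒≤ s<t)) ⟨
        + (toℕ s ℕ.+ (toℕ t ∸ toℕ s)) * α          ≡⟨ ℤₚ.*-distribʳ-+ α (+ toℕ s) (+ (toℕ t ∸ toℕ s)) ⟩
        + toℕ s * α + + (toℕ t ∸ toℕ s) * α        ∎

  -- Let e be a place where c and c′ differ. Five translates of e by multiples of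
  -- β cannot all be among the points w, so c = c′ at some e + γ with γ a multiple
  -- of β, and hence c (e + γ) ≠ c e. Then c and c′ differ at e + s α or at
  -- e + s α + γ, for each of five values of s; two of these places coincide, and
  -- this makes γ a multiple of α.
  module _ (w : Fin 4 → ℤ) {c c′ α β} (per : Periodic c) (per′ : Periodic c′)
    (α≉0 : α ≉ 0ℤ) (β≉0 : β ≉ 0ℤ) (inv : Invariant α c) (inv′ : Invariant β c′)
    (differ : ∀ v → c v ≢ c′ v → ∃ λ m → v ≈ w m) where

    agreeing-translate : ∀ e → ∃ λ t → c (e + + t * β) ≡ c′ (e + + t * β)
    agreeing-translate e with any? (λ (t : Fin 5) → c (e + + toℕ t * β) ≟ᵇ c′ (e + + toℕ t * β))
    ... | yes (t , eq) = toℕ t , eq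
    ... | no none = ⊥-elim (collide (pigeonhole (ℕₚ.n<1+n 4) (proj₁ ∘ place)))
      where
      place : (t : Fin 5) → ∃ λ m → e + + toℕ t * β ≈ w m
      place t = differ _ (λ eq → none (t , eq))
      collide : (∃ λ s → ∃ λ t → s Fin.< t × proj₁ (place s) ≡ proj₁ (place t)) → ⊥
      collide (s , t , s<t , eq) with k , split , k≉0 ← gap β≉0 s<t = k≉0
        (deduce one (e ∷ + toℕ s * β ∷ + k * β ∷ w (proj₁ (place s)) ∷ [])
            (λ e s k m → (-1ℤ , e ⊕ s ≐ m) ∷ (1ℤ , e ⊕ (s ⊕ k) ≐ m) ∷ [] ⊢ k ≐ nil) refl
          (proj₂ (place s)) (subst₂ (λ i m → e + i ≈ w m) split (sym eq) (proj₂ (place t))))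

    rotations-agree : ∀ e → c e ≡ c′ e
    rotations-agree e with c e ≟ᵇ c′ e
    ... | yes eq = eq
    ... | no ce≢c′e with agreeing-translate e
    ...   | t , agree = ⊥-elim (collide (pigeonhole (ℕₚ.n<1+n 4) (proj₁ ∘ place)))
      where
      γ : ℤ
      γ = + t * β
      ceγ≢ce : c (e + γ) ≢ c e
      ceγ≢ce eq = ce≢c′e (trans (sym eq) (trans agree (multiple-invariant per′ inv′ t e)))
      Place : Fin 5 → Fin 4 → Set
      Place s m = e + + toℕ s * α ≈ w m ⊎ e + + toℕ s * α + γ ≈ w m
      place : (s : Fin 5) → ∃ (Place s)
      place s with c (e + + toℕ s * α) ≟ᵇ c′ (e + + toℕ s * α)
      ... | no ≢   = map₂ inj₁ (differ _ ≢)
      ... | yes eq = map₂ inj₂ (differ _ λ eq′ → ceγ≢ce (begin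
        c (e + γ)                       ≡⟨ multiple-invariant per inv (toℕ s) (e + γ) ⟨
        c (e + γ + + toℕ s * α)         ≡⟨ per (deduce one (e ∷ γ ∷ + toℕ s * α ∷ [])
            (λ e g s → [] ⊢ e ⊕ g ⊕ s ≐ e ⊕ s ⊕ g) refl) ⟩
        c (e + + toℕ s * α + γ)         ≡⟨ eq′ ⟩
        c′ (e + + toℕ s * α + γ)        ≡⟨ multiple-invariant per′ inv′ t (e + + toℕ s * α) ⟩
        c′ (e + + toℕ s * α)            ≡⟨ eq ⟨
        c (e + + toℕ s * α)             ≡⟨ multiple-invariant per inv (toℕ s) e ⟩
        c e                             ∎))
        where open ≡-Reasoning
      clash : ∀ {s k m} → + k * α ≉ 0ℤ →
        e + s ≈ w m ⊎ e + s + γ ≈ w m → e + (s + + k * α) ≈ w m ⊎ e + (s + + k * α) + γ ≈ w m → ⊥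
      clash {s} {k} {m} k≉0 (inj₁ p) (inj₁ q) =
        k≉0 (deduce one (e ∷ s ∷ + k * α ∷ w m ∷ [])
            (λ e s k m → (-1ℤ , e ⊕ s ≐ m) ∷ (1ℤ , e ⊕ (s ⊕ k) ≐ m) ∷ [] ⊢ k ≐ nil) refl p q)
      clash {s} {k} {m} k≉0 (inj₁ p) (inj₂ q) = ceγ≢ce (trans
        (sym (multiple-invariant per inv k (e + γ)))
        (per (deduce one (e ∷ s ∷ + k * α ∷ w m ∷ γ ∷ [])
            (λ e s k m g → (-1ℤ , e ⊕ s ≐ m) ∷ (1ℤ , e ⊕ (s ⊕ k) ⊕ g ≐ m) ∷ []
               ⊢ e ⊕ g ⊕ k ≐ e) refl p q)))
      clash {s} {k} {m} k≉0 (inj₂ p) (inj₁ q) = ceγ≢ce (trans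
        (per (deduce one (e ∷ s ∷ + k * α ∷ w m ∷ γ ∷ [])
            (λ e s k m g → (1ℤ , e ⊕ s ⊕ g ≐ m) ∷ (-1ℤ , e ⊕ (s ⊕ k) ≐ m) ∷ []
               ⊢ e ⊕ g ≐ e ⊕ k) refl p q))
        (multiple-invariant per inv k e))
      clash {s} {k} {m} k≉0 (inj₂ p) (inj₂ q) =
        k≉0 (deduce one (e ∷ s ∷ + k * α ∷ w m ∷ γ ∷ [])
            (λ e s k m g → (-1ℤ , e ⊕ s ⊕ g ≐ m) ∷ (1ℤ , e ⊕ (s ⊕ k) ⊕ g ≐ m) ∷ []
               ⊢ k ≐ nil) refl p q)
      collide : (∃ λ s → ∃ λ s′ → s Fin.< s′ × proj₁ (place s) ≡ proj₁ (place s′)) → ⊥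
      collide (s , s′ , s<s′ , eq) with k , split , k≉0 ← gap α≉0 s<s′ =
        clash {+ toℕ s * α} {k} {proj₁ (place s)} k≉0 (proj₂ (place s))
          (subst₂ (λ i m → e + i ≈ w m ⊎ e + i + γ ≈ w m) split (sym eq) (proj₂ (place s′)))

-- Extending colourings of the cycle

elements : ∀ {n m} (W : Subset n) → m ≤ Subset.∣ W ∣ →
  ∃ λ (w : Fin m → Fin n) → (∀ i → w i ∈ W) × (∀ {i j} → w i ≡ w j → i ≡ j)
elements {m = ℕ.zero}  W _ = (λ ()) , (λ ()) , λ {}
elements {m = ℕ.suc m} (outside ∷ W) m≤ with w , w∈W , inj ← elements W m≤ =
  suc ∘ w , thereᵛ ∘ w∈W , inj ∘ suc-injective
elements {m = ℕ.suc m} (inside ∷ W) (s≤s m≤) with w , w∈W , inj ← elements W m≤ =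
  (λ { zero → zero ; (suc i) → suc (w i) }) , (λ { zero → hereᵛ ; (suc i) → thereᵛ (w∈W i) }) ,
  λ { {zero} {zero} _ → refl ; {suc i} {suc j} eq → cong suc (inj (suc-injective eq)) }

missing-index : ∀ (S : List (Fin 4)) → length S ≤ 3 → ∃ λ m → ¬ m ∈ˡ S
missing-index S S≤3 with any? (λ m → ¬? (m ∈ˡ? S))
... | yes found = found
... | no  all   = ⊥-elim (collide (pigeonhole (s≤s S≤3) (index ∘ member)))
  where
  member : ∀ m → m ∈ˡ S
  member m = decidable-stable (m ∈ˡ? S) (λ m∉S → all (m , m∉S))
  collide : (∃ λ i → ∃ λ j → i Fin.< j × index (member i) ≡ index (member j)) → ⊥
  collide (i , j , i<j , eq) =
    ℕₚ.<-irrefl (cong toℕ (index-injective (setoid _) (member i) (member j) eq)) i<j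

-- Passing between integers and vertices

module Residues (n : ℕ) .{{_ : NonZero n}} where

  open Congruence n

  residue : ℤ → Fin n
  residue i = fromℕ< (n%ℕd<d i n)

  toℤ : Fin n → ℤ
  toℤ v = + toℕ v

  toℤ-residue : ∀ i → toℤ (residue i) ≈ i
  toℤ-residue i = congruent (divides (- (i /ℕ n)) (begin
    toℤ (residue i) - i                                    ≡⟨ cong (λ m → + m - i) (toℕ-fromℕ< (n%ℕd<d i n)) ⟩
    r - i                                                  ≡⟨ cong (_-_ r) (a≡a%ℕn+[a/ℕn]*n i n) ⟩
    r - (r + (i /ℕ n) * + n)                               ≡⟨ regroup r (i /ℕ n) (+ n) ⟩
    - (i /ℕ n) * + n                                       ∎))
    where
    open ≡-Reasoning
    r = + (i %ℕ n)
    regroup : ∀ r q m → r - (r + q * m) ≡ - q * m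
    regroup = solve-∀

  toℤ-injective : ∀ {u v} → toℤ u ≈ toℤ v → u ≡ v
  toℤ-injective {u} {v} u≈v = toℕ-injective (ℕₚ.≤-antisym
    (bound u v u≈v)
    (bound v u (≈-sym u≈v)))
    where
    bound : ∀ u v → toℤ u ≈ toℤ v → toℕ u ≤ toℕ v
    bound u v (congruent d) with toℕ u ≤? toℕ v
    ... | yes u≤v = u≤v
    ... | no  u≰v = ⊥-elim (>⇒∤ {{ℕ.>-nonZero (ℕₚ.m<n⇒0<n∸m v<u)}}
      (ℕₚ.≤-<-trans (ℕₚ.m∸n≤m (toℕ u) (toℕ v)) (toℕ<n u))
      (subst (n ∣_) (cong ℤ.∣_∣ (trans (ℤₚ.m-n≡m⊖n (toℕ u) (toℕ v)) (ℤₚ.⊖-≥ (ℕₚ.<⇒≤ v<u)))) (∣⇒∣ᵤ d)))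
      where
      v<u : toℕ v < toℕ u
      v<u = ℕₚ.≰⇒> u≰v

  residue-cong : ∀ {i j} → i ≈ j → residue i ≡ residue j
  residue-cong {i} {j} i≈j = toℤ-injective
    (deduce one (i ∷ j ∷ toℤ (residue i) ∷ toℤ (residue j) ∷ [])
        (λ i j r s → (1ℤ , r ≐ i) ∷ (1ℤ , i ≐ j) ∷ (-1ℤ , s ≐ j) ∷ [] ⊢ r ≐ s) refl
          (toℤ-residue i) i≈j (toℤ-residue j))

  residue-toℤ : ∀ v → residue (toℤ v) ≡ v
  residue-toℤ v = toℤ-injective (toℤ-residue (toℤ v))

  residue-injective : ∀ {i j} → residue i ≡ residue j → i ≈ j
  residue-injective {i} {j} eq =
    deduce one (i ∷ j ∷ toℤ (residue i) ∷ [])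
        (λ i j r → (-1ℤ , r ≐ i) ∷ (1ℤ , r ≐ j) ∷ [] ⊢ i ≐ j) refl
          (toℤ-residue i) (subst (λ v → toℤ v ≈ j) (sym eq) (toℤ-residue j))

  -- For rotations the analogous equation holds by computation. For reflections `act` adds
  -- `n ∸ toℕ v`, which exceeds -v by one full turn.
  act-ref : ∀ a v → act (ref a) v ≡ residue (toℤ a - toℤ v)
  act-ref a v = residue-cong {+ (toℕ a ℕ.+ (n ∸ toℕ v))} {toℤ a - toℤ v} (congruent (divides 1ℤ (begin
    + (toℕ a ℕ.+ (n ∸ toℕ v)) - (toℤ a - toℤ v)    ≡⟨ cong (λ i → toℤ a + i - (toℤ a - toℤ v)) complement ⟩
    toℤ a + (+ n - toℤ v) - (toℤ a - toℤ v)        ≡⟨ regroup (toℤ a) (+ n) (toℤ v) ⟩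
    1ℤ * + n                                       ∎)))
    where
    open ≡-Reasoning
    complement : + (n ∸ toℕ v) ≡ + n - toℤ v
    complement = sym (trans (ℤₚ.m-n≡m⊖n n (toℕ v)) (ℤₚ.⊖-≥ (ℕₚ.<⇒≤ (toℕ<n v))))
    regroup : ∀ a m v → a + (m - v) - (a - v) ≡ 1ℤ * m
    regroup = solve-∀

module Extension (n : ℕ) .{{_ : NonZero n}}
  (two : Congruence.Cancellable n (+ 2)) (three : Congruence.Cancellable n (+ 3))
  (five : Congruence.Cancellable n (+ 5))
  (half : ∀ a → ∃ λ x → Congruence._≈_ n (x + x) a) where

  open Congruence n
  open Colourings n two three five
  open Residues n

  RotationSymmetric : (Fin n → Bool) → Set
  RotationSymmetric b = ∃ λ a → toℤ a ≉ 0ℤ × (∀ v → b (act (rot a) v) ≡ b v)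

  ReflectionSymmetric : (Fin n → Bool) → Set
  ReflectionSymmetric b = ∃ λ a → ∀ v → b (act (ref a) v) ≡ b v

  rotationSymmetric? : ∀ b → Dec (RotationSymmetric b)
  rotationSymmetric? b = any? λ a → ¬? (toℤ a ≈? 0ℤ) ×-dec all? λ v → b (act (rot a) v) ≟ᵇ b v

  reflectionSymmetric? : ∀ b → Dec (ReflectionSymmetric b)
  reflectionSymmetric? b = any? λ a → all? λ v → b (act (ref a) v) ≟ᵇ b v

  Asymmetric : (Fin n → Bool) → Set
  Asymmetric b = ¬ RotationSymmetric b × ¬ ReflectionSymmetric b

  module _ {c : Colouring} (per : Periodic c) {b : Fin n → Bool} (b≗c : ∀ v → b v ≡ c (toℤ v)) where

    b-residue : ∀ i → b (residue i) ≡ c i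
    b-residue i = trans (b≗c (residue i)) (per (toℤ-residue i))

    rotation⇒invariant : RotationSymmetric b → ∃ λ α → α ≉ 0ℤ × Invariant α c
    rotation⇒invariant (a , a≉0 , preserves) = toℤ a , a≉0 , λ v → begin
      c (v + toℤ a)                          ≡⟨ per (deduce one (v ∷ toℤ a ∷ toℤ (residue v) ∷ [])
          (λ v a r → (-1ℤ , r ≐ v) ∷ [] ⊢ v ⊕ a ≐ r ⊕ a) refl (toℤ-residue v)) ⟩
      c (toℤ (residue v) + toℤ a)            ≡⟨ b-residue (toℤ (residue v) + toℤ a) ⟨
      b (act (rot a) (residue v))            ≡⟨ preserves (residue v) ⟩
      b (residue v)                          ≡⟨ b-residue v ⟩
      c v                                    ∎
      where open ≡-Reasoning

    -- The hypothesis `half` supplies a centre: the reflection v ↦ a - v is the one about x when 2x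
    -- ≈ a.
    reflection⇒symmetric : ReflectionSymmetric b → ∃ λ x → Symmetric x c
    reflection⇒symmetric (a , preserves) with x , 2x≈a ← half (toℤ a) = x , λ v → begin
      c (x + x - v)                          ≡⟨ per (deduce one (x ∷ v ∷ toℤ a ∷ toℤ (residue v) ∷ [])
          (λ x v a r → (1ℤ , r ≐ v) ∷ (1ℤ , x ⊕ x ≐ a) ∷ [] ⊢ x ⊕ x ⊖ v ≐ a ⊖ r) refl
            (toℤ-residue v) 2x≈a) ⟩
      c (toℤ a - toℤ (residue v))            ≡⟨ b-residue (toℤ a - toℤ (residue v)) ⟨
      b (residue (toℤ a - toℤ (residue v)))  ≡⟨ cong b (act-ref a (residue v)) ⟨
      b (act (ref a) (residue v))            ≡⟨ preserves (residue v) ⟩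
      b (residue v)                          ≡⟨ b-residue v ⟩
      c v                                    ∎
      where open ≡-Reasoning

    ¬rotation⇒rotationFree : ¬ RotationSymmetric b → RotationFree c
    ¬rotation⇒rotationFree ¬rotation α inv with α ≈? 0ℤ
    ... | yes α≈0 = α≈0
    ... | no  α≉0 = ⊥-elim (¬rotation (residue α
      , (λ e → α≉0 (deduce one (α ∷ toℤ (residue α) ∷ [])
          (λ a r → (-1ℤ , r ≐ a) ∷ (1ℤ , r ≐ nil) ∷ [] ⊢ a ≐ nil) refl (toℤ-residue α) e))
      , λ v → begin
          b (act (rot (residue α)) v)        ≡⟨ b-residue (toℤ v + toℤ (residue α)) ⟩
          c (toℤ v + toℤ (residue α))        ≡⟨ per (deduce one (α ∷ toℤ (residue α) ∷ toℤ v ∷ [])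
              (λ a r v → (1ℤ , r ≐ a) ∷ [] ⊢ v ⊕ r ≐ v ⊕ a) refl (toℤ-residue α)) ⟩
          c (toℤ v + α)                      ≡⟨ inv (toℤ v) ⟩
          c (toℤ v)                          ≡⟨ b≗c v ⟨
          b v                                ∎))
      where open ≡-Reasoning

  module _ (w : Fin 4 → Fin n) (w-injective : ∀ {i j} → w i ≡ w j → i ≡ j) (f : Fin n → Bool) where

    wᶻ : Fin 4 → ℤ
    wᶻ i = toℤ (w i)

    wᶻ-injective : ∀ {i j} → i ≢ j → wᶻ i ≉ wᶻ j
    wᶻ-injective i≢j e = i≢j (w-injective (toℤ-injective e))

    Extends : (Fin n → Bool) → Set
    Extends b = ∀ v → (∀ m → v ≢ w m) → b v ≡ f v

    extends? : ∀ b → Dec (Extends b)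
    extends? b = all? λ v → all? (λ m → ¬? (v ≟ w m)) →-dec (b v ≟ᵇ f v)

    Extendsᶻ : Colouring → Set
    Extendsᶻ c = ∀ v → (∀ m → v ≉ wᶻ m) → c v ≡ f (residue v)

    restrict : ∀ {c b} → (∀ v → b v ≡ c (toℤ v)) → Extendsᶻ c → Extends b
    restrict {c} {b} b≗c ext v v≢w = trans (b≗c v)
      (trans (ext (toℤ v) (λ m e → v≢w m (toℤ-injective e))) (cong f (residue-toℤ v)))

    -- Vertex colourings are written as `lookup S` because a search through all subsets decides
    -- whether an asymmetric extension exists; this justifies arguing by contradiction.
    module _ (none : ¬ ∃ λ S → Asymmetric (lookup S) × Extends (lookup S)) where

      sampled : (c : Colouring) → ∀ v → lookup (tabulate (c ∘ toℤ)) v ≡ c (toℤ v)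
      sampled c = lookup∘tabulate (c ∘ toℤ)

      symmetry : ∀ c → Periodic c → Extendsᶻ c → (∃ λ α → α ≉ 0ℤ × Invariant α c) ⊎ ∃ (Good c)
      symmetry c per ext = decide (rotationSymmetric? (lookup S)) (reflectionSymmetric? (lookup S))
        where
        S : Subset n
        S = tabulate (c ∘ toℤ)
        decide : Dec (RotationSymmetric (lookup S)) → Dec (ReflectionSymmetric (lookup S)) → _
        decide (yes r) _       = inj₁ (rotation⇒invariant per (sampled c) r)
        decide (no ¬r) (no ¬s) = ⊥-elim (none (S , (¬r , ¬s) , restrict (sampled c) ext))
        decide (no ¬r) (yes s) = inj₂ (map₂ (λ sym-x → record
          { periodic = per ; symmetric = sym-x
          ; rotationFree = ¬rotation⇒rotationFree per (sampled c) ¬r })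
          (reflection⇒symmetric per (sampled c) s))

      module _ (c₀ : Colouring) (per₀ : Periodic c₀) (ext₀ : Extendsᶻ c₀) where

        toggled-extends : ∀ S → Extendsᶻ (toggled wᶻ c₀ S)
        toggled-extends S v off = trans (toggled-off wᶻ c₀ S v (λ {i} _ → off i)) (ext₀ v off)

        ¬rotation-free : ¬ (∀ S → length S ≤ 3 → ∀ α → α ≉ 0ℤ → ¬ Invariant α (toggled wᶻ c₀ S))
        ¬rotation-free free = Toggles.impossible wᶻ wᶻ-injective c₀ centre good
          where
          goodness : ∀ S → length S ≤ 3 → ∃ (Good (toggled wᶻ c₀ S))
          goodness S S≤3 with symmetry (toggled wᶻ c₀ S) (toggled-periodic wᶻ per₀ S) (toggled-extends S)
          ... | inj₁ (α , α≉0 , inv) = ⊥-elim (free S S≤3 α α≉0 inv)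
          ... | inj₂ g               = g
          centre : List (Fin 4) → ℤ
          centre S with length S ≤? 3
          ... | yes S≤3 = proj₁ (goodness S S≤3)
          -- A default value: `good` speaks only of lists of length at most 3.
          ... | no  _   = 0ℤ
          good : ∀ S → length S ≤ 3 → Good (toggled wᶻ c₀ S) (centre S)
          good S S≤3 with length S ≤? 3
          ... | yes S≤3′ = proj₂ (goodness S S≤3′)
          ... | no  S≰3  = ⊥-elim (S≰3 S≤3)

      -- Only one colouring can be rotation symmetric; starting from the colouring
      -- that differs from it at all four points, up to three toggles never reach it.
      ¬rotation : ∀ S → Extends (lookup S) → ¬ RotationSymmetric (lookup S)
      ¬rotation S ext r = ¬rotation-free c₀ per₀ ext₀ λ T T≤3 β β≉0 inv →
        far T T≤3 (rotations-agree wᶻ per (toggled-periodic wᶻ per₀ T) α≉0 β≉0 α-inv inv (differ T))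
        where
        c : Colouring
        c = lookup S ∘ residue
        per : Periodic c
        per = cong (lookup S) ∘ residue-cong
        rotation : ∃ λ α → α ≉ 0ℤ × Invariant α c
        rotation = rotation⇒invariant per (λ v → cong (lookup S) (sym (residue-toℤ v))) r
        α≉0 = proj₁ (proj₂ rotation)
        α-inv = proj₂ (proj₂ rotation)
        among? : ∀ v → Dec (∃ λ m → v ≈ wᶻ m)
        among? v = any? λ m → v ≈? wᶻ m
        c₀ : Colouring
        c₀ v = c v xor does (among? v)
        per₀ : Periodic c₀
        per₀ {u} {v} u≈v = cong₂ _xor_ (per u≈v) (does-⇔ (mk⇔
          (map₂ λ {m} → deduce one (u ∷ v ∷ wᶻ m ∷ [])
              (λ u v m → (-1ℤ , u ≐ v) ∷ (1ℤ , u ≐ m) ∷ [] ⊢ v ≐ m) refl u≈v)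
          (map₂ λ {m} → deduce one (u ∷ v ∷ wᶻ m ∷ [])
              (λ u v m → (1ℤ , u ≐ v) ∷ (1ℤ , v ≐ m) ∷ [] ⊢ u ≐ m) refl
                u≈v)) (among? u) (among? v))
        c₀-off : ∀ v → (∀ m → v ≉ wᶻ m) → c₀ v ≡ c v
        c₀-off v off = trans (cong (c v xor_) (dec-false (among? v) λ (m , e) → off m e)) (xor-identityʳ (c v))
        ext₀ : Extendsᶻ c₀
        ext₀ v off = trans (c₀-off v off) (ext (residue v) λ m eq → off m
          (deduce one (v ∷ toℤ (residue v) ∷ wᶻ m ∷ [])
              (λ v r m → (-1ℤ , r ≐ v) ∷ (1ℤ , r ≐ m) ∷ [] ⊢ v ≐ m) refl
                (toℤ-residue v) (subst (λ u → toℤ (residue v) ≈ toℤ u) eq ≈-refl)))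
        differ : ∀ T v → c v ≢ toggled wᶻ c₀ T v → ∃ λ m → v ≈ wᶻ m
        differ T v c≢ with among? v
        ... | yes m   = m
        ... | no  off = ⊥-elim (c≢ (sym (trans
          (toggled-off wᶻ c₀ T v (λ {i} _ e → off (i , e))) (c₀-off v (λ m e → off (m , e))))))
        far : ∀ T → length T ≤ 3 → ¬ (∀ v → c v ≡ toggled wᶻ c₀ T v)
        far T T≤3 agree with m , m∉T ← missing-index T T≤3 = not-¬ {c (wᶻ m)} refl (begin
          c (wᶻ m)                          ≡⟨ agree (wᶻ m) ⟩
          toggled wᶻ c₀ T (wᶻ m)            ≡⟨ toggled-off wᶻ c₀ T (wᶻ m) off ⟩
          c (wᶻ m) xor does (among? (wᶻ m)) ≡⟨ cong (c (wᶻ m) xor_) (dec-true (among? (wᶻ m)) (m , ≈-refl)) ⟩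
          c (wᶻ m) xor true                 ≡⟨ xor-comm (c (wᶻ m)) true ⟩
          not (c (wᶻ m))                    ∎)
          where
          open ≡-Reasoning
          off : ∀ {i} → i ∈ˡ T → wᶻ m ≉ wᶻ i
          off i∈T e = m∉T (subst (_∈ˡ T) (sym (w-injective (toℤ-injective e))) i∈T)

      -- Since `¬rotation` applies to every extension, any starting colouring will do for
      -- `¬rotation-free`; the given `f` is taken.
      contradictory : ⊥
      contradictory = ¬rotation-free c₁ per₁ ext₁ λ S S≤3 α α≉0 inv →
        let T = tabulate (toggled wᶻ c₁ S ∘ toℤ)
            T≗ = sampled (toggled wᶻ c₁ S)
            extends = restrict T≗ (toggled-extends c₁ per₁ ext₁ S)
        in α≉0 (¬rotation⇒rotationFree (toggled-periodic wᶻ per₁ S) T≗ (¬rotation T extends) α inv)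
        where
        c₁ : Colouring
        c₁ = f ∘ residue
        per₁ : Periodic c₁
        per₁ = cong f ∘ residue-cong
        ext₁ : Extendsᶻ c₁
        ext₁ v off = refl

    asymmetric-extension : ∃ λ b → Asymmetric b × Extends b
    asymmetric-extension with anySubset? (λ S →
      (¬? (rotationSymmetric? (lookup S)) ×-dec ¬? (reflectionSymmetric? (lookup S))) ×-dec extends? (lookup S))
    ... | yes (S , found) = lookup S , found
    ... | no none         = ⊥-elim (contradictory none)

  colour : Bool → Fin 2
  colour false = 0F
  colour true  = 1F

  bit : Fin 2 → Bool
  bit 0F = false
  bit 1F = true

  bit-colour : ∀ b → bit (colour b) ≡ b
  bit-colour false = refl
  bit-colour true  = refl

  colour-bit : ∀ k → colour (bit k) ≡ k
  colour-bit 0F = refl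
  colour-bit 1F = refl

  asymmetric⇒distinguishing : ∀ {b} → Asymmetric b → Distinguishing (colour ∘ b)
  asymmetric⇒distinguishing {b} (¬rotation , ¬reflection) g preserves = go g preserves
    where
    decode : ∀ {u v} → colour (b u) ≡ colour (b v) → b u ≡ b v
    decode {u} {v} eq = trans (sym (bit-colour (b u))) (trans (cong bit eq) (bit-colour (b v)))
    go : ∀ g → (∀ v → colour (b (act g v)) ≡ colour (b v)) → IsIdentity g
    go (ref a) preserves = ⊥-elim (¬reflection (a , λ v → decode (preserves v)))
    go (rot a) preserves v with toℤ a ≈? 0ℤ
    ... | no  a≉0 = ⊥-elim (¬rotation (a , a≉0 , λ v → decode (preserves v)))
    ... | yes a≈0 = trans (residue-cong (deduce one (toℤ v ∷ toℤ a ∷ [])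
        (λ v a → (1ℤ , a ≐ nil) ∷ [] ⊢ v ⊕ a ≐ v) refl a≈0)) (residue-toℤ v)

  extension : ∀ (W : Subset n) → 4 ≤ Subset.∣ W ∣ → (f : Coloring n 2) →
    Σ (Coloring n 2) λ c → Distinguishing c × (∀ v → v ∉ W → c v ≡ f v)
  extension W 4≤∣W∣ f with w , w∈W , w-injective ← elements W 4≤∣W∣
    with b , asym , ext ← asymmetric-extension w w-injective (bit ∘ f) =
    colour ∘ b , asymmetric⇒distinguishing asym , λ v v∉W →
      trans (cong colour (ext v λ m v≡wm → v∉W (subst (_∈ W) (sym v≡wm) (w∈W m)))) (colour-bit (f v))

-- Three points are not enough

module LowerBound (k : ℕ) (7≤n : 7 ≤ 3 ℕ.+ k) where

  n : ℕ
  n = 3 ℕ.+ k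

  open Congruence n
  open Residues n

  far : ∀ i j .{{_ : NonZero ℤ.∣ i - j ∣}} {_ : True (ℤ.∣ i - j ∣ ≤? 6)} → i ≉ j
  far i j {≤6} (congruent d) = >⇒∤ (ℕₚ.≤-trans (s≤s (toWitness ≤6)) 7≤n) (∣⇒∣ᵤ d)

  W : Subset n
  W = inside ∷ inside ∷ inside ∷ Subset.⊥

  -- Fixing 0 means a ≈ 0 and fixing 1 means a ≈ 2, but 0 and 2 are incongruent. This serves both to
  -- show that `W` is fixing and to see that a reflection is not the identity.
  ¬two-fixed-points : ∀ a → act (ref a) 0F ≡ 0F → act (ref a) 1F ≢ 1F
  ¬two-fixed-points a fixed₀ fixed₁ = far (+ 2) (+ 0)
    (deduce one (toℤ a ∷ + 0 ∷ + 1 ∷ [])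
        (λ a z o → (1ℤ , a ⊖ z ≐ z) ∷ (-1ℤ , a ⊖ o ≐ o) ∷ [] ⊢ o ⊕ o ≐ z ⊕ z) refl
      (residue-injective {toℤ a - + 0} {+ 0} (trans (sym (act-ref a 0F)) fixed₀))
      (residue-injective {toℤ a - + 1} {+ 1} (trans (sym (act-ref a 1F)) fixed₁)))

  3≤∣W∣ : 3 ≤ Subset.∣ W ∣
  3≤∣W∣ = s≤s (s≤s (s≤s z≤n))

  fixing : FixingSet W
  fixing (rot a) moves with act (rot a) 0F ≟ 0F
  ... | no  moved = 0F , hereᵛ , moved
  ... | yes fixed = ⊥-elim (moves λ v → trans
    (residue-cong (deduce one (toℤ v ∷ toℤ a ∷ [])
        (λ v a → (1ℤ , nil ⊕ a ≐ nil) ∷ [] ⊢ v ⊕ a ≐ v) refl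
          (residue-injective {+ 0 + toℤ a} {+ 0} fixed)))
    (residue-toℤ v))
  fixing (ref a) moves with act (ref a) 0F ≟ 0F | act (ref a) 1F ≟ 1F
  ... | no moved   | _            = 0F , hereᵛ , moved
  ... | yes _      | no moved     = 1F , thereᵛ hereᵛ , moved
  ... | yes fixed₀ | yes fixed₁   = ⊥-elim (¬two-fixed-points a fixed₀ fixed₁)

  module _ (c : Coloring n 2) (off-W : ∀ v → v ∉ W → c v ≡ 0F) where

    C : ℤ → Fin 2
    C i = c (residue i)

    C-cong : ∀ {i j} → i ≈ j → C i ≡ C j
    C-cong = cong c ∘ residue-cong

    off : ∀ i → i ≉ + 0 → i ≉ + 1 → i ≉ + 2 → C i ≡ 0F
    off i ≉0 ≉1 ≉2 = off-W (residue i) (outside-W (residue i) (≈-sym (toℤ-residue i)))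
      where
      outside-W : ∀ v → i ≈ toℤ v → v ∉ W
      outside-W 0F                e _ = ≉0 e
      outside-W 1F                e _ = ≉1 e
      outside-W 2F                e _ = ≉2 e
      outside-W (suc (suc (suc v))) e (thereᵛ (thereᵛ (thereᵛ v∈⊥))) = ∉⊥ v∈⊥

    -- If neither i nor a - i lies in {0, 1, 2}, both have colour 0. Otherwise one of them does, and
    -- the reflection being an involution reduces the claim to the three given equations.
    mirrored-on-W : ∀ a → C (a - + 0) ≡ C (+ 0) → C (a - + 1) ≡ C (+ 1) → C (a - + 2) ≡ C (+ 2) →
      ∀ i → C (a - i) ≡ C i
    mirrored-on-W a e₀ e₁ e₂ i = go (i ≈? + 0) (i ≈? + 1) (i ≈? + 2)
      (a - i ≈? + 0) (a - i ≈? + 1) (a - i ≈? + 2)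
      where
      source : ∀ {j} → C (a - j) ≡ C j → i ≈ j → C (a - i) ≡ C i
      source {j} e f = trans (C-cong (deduce one (a ∷ i ∷ j ∷ [])
          (λ a i j → (-1ℤ , i ≐ j) ∷ [] ⊢ a ⊖ i ≐ a ⊖ j) refl f)) (trans e (sym (C-cong f)))
      target : ∀ {j} → C (a - j) ≡ C j → a - i ≈ j → C (a - i) ≡ C i
      target {j} e f = trans (C-cong f) (trans (sym e) (C-cong (deduce one (a ∷ i ∷ j ∷ [])
          (λ a i j → (1ℤ , a ⊖ i ≐ j) ∷ [] ⊢ a ⊖ j ≐ i) refl f)))
      go : Dec (i ≈ + 0) → Dec (i ≈ + 1) → Dec (i ≈ + 2) →
        Dec (a - i ≈ + 0) → Dec (a - i ≈ + 1) → Dec (a - i ≈ + 2) → C (a - i) ≡ C i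
      go (yes f) _ _ _ _ _ = source e₀ f
      go _ (yes f) _ _ _ _ = source e₁ f
      go _ _ (yes f) _ _ _ = source e₂ f
      go _ _ _ (yes f) _ _ = target e₀ f
      go _ _ _ _ (yes f) _ = target e₁ f
      go _ _ _ _ _ (yes f) = target e₂ f
      go (no f₀) (no f₁) (no f₂) (no g₀) (no g₁) (no g₂) =
        trans (off (a - i) g₀ g₁ g₂) (sym (off i f₀ f₁ f₂))

    mirrored⇒¬distinguishing : ∀ a → (∀ i → C (a - i) ≡ C i) → ¬ Distinguishing c
    mirrored⇒¬distinguishing a mirrored dist = ¬two-fixed-points (residue a) (identity 0F) (identity 1F)
      where
      preserves : ∀ v → c (act (ref (residue a)) v) ≡ c v
      preserves v = begin
        c (act (ref (residue a)) v)     ≡⟨ cong c (act-ref (residue a) v) ⟩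
        C (toℤ (residue a) - toℤ v)     ≡⟨ C-cong (deduce one (toℤ (residue a) ∷ a ∷ toℤ v ∷ [])
            (λ r a v → (1ℤ , r ≐ a) ∷ [] ⊢ r ⊖ v ≐ a ⊖ v) refl (toℤ-residue a)) ⟩
        C (a - toℤ v)                   ≡⟨ mirrored (toℤ v) ⟩
        C (toℤ v)                       ≡⟨ cong c (residue-toℤ v) ⟩
        c v                             ∎
        where open ≡-Reasoning
      identity : IsIdentity (ref (residue a))
      identity = dist (ref (residue a)) preserves

    ¬distinguishing : ¬ Distinguishing c
    ¬distinguishing = go (C (+ 0)) (C (+ 1)) (C (+ 2)) refl refl refl
      where
      about : ∀ a → C (a - + 0) ≡ C (+ 0) → C (a - + 1) ≡ C (+ 1) → C (a - + 2) ≡ C (+ 2) → ¬ Distinguishing c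
      about a p q r = mirrored⇒¬distinguishing a (mirrored-on-W a p q r)
      C[-2]≡0 : C (- + 2) ≡ 0F
      C[-2]≡0 = off (- + 2) (far (- + 2) (+ 0)) (far (- + 2) (+ 1)) (far (- + 2) (+ 2))
      C[-1]≡0 : C (- + 1) ≡ 0F
      C[-1]≡0 = off (- + 1) (far (- + 1) (+ 0)) (far (- + 1) (+ 1)) (far (- + 1) (+ 2))
      C[3]≡0 : C (+ 3) ≡ 0F
      C[3]≡0 = off (+ 3) (far (+ 3) (+ 0)) (far (+ 3) (+ 1)) (far (+ 3) (+ 2))
      C[4]≡0 : C (+ 4) ≡ 0F
      C[4]≡0 = off (+ 4) (far (+ 4) (+ 0)) (far (+ 4) (+ 1)) (far (+ 4) (+ 2))
      -- The vertices of colour 1 among 0, 1, 2 are always symmetric about a/2, where `a` is the sum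
      -- of the least and the greatest of them; if there are none, a = 2 is taken.
      go : ∀ p q r → C (+ 0) ≡ p → C (+ 1) ≡ q → C (+ 2) ≡ r → ¬ Distinguishing c
      go 0F _  0F e₀ e₁ e₂ = about (+ 2) (trans e₂ (sym e₀)) refl (trans e₀ (sym e₂))
      go 1F _  1F e₀ e₁ e₂ = about (+ 2) (trans e₂ (sym e₀)) refl (trans e₀ (sym e₂))
      go 0F 0F 1F e₀ e₁ e₂ = about (+ 4) (trans C[4]≡0 (sym e₀)) (trans C[3]≡0 (sym e₁)) refl
      go 0F 1F 1F e₀ e₁ e₂ = about (+ 3) (trans C[3]≡0 (sym e₀)) (trans e₂ (sym e₁)) (trans e₁ (sym e₂))
      go 1F 0F 0F e₀ e₁ e₂ = about (+ 0) refl (trans C[-1]≡0 (sym e₁)) (trans C[-2]≡0 (sym e₂))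
      go 1F 1F 0F e₀ e₁ e₂ = about (+ 1) (trans e₁ (sym e₀)) (trans e₀ (sym e₁)) (trans C[-1]≡0 (sym e₂))

  ¬ext : ∀ m → m < 4 → ¬ ExtProp n 2 m
  ¬ext m (s≤s m≤3) ext with c , dist , off-W ← ext W fixing (ℕₚ.≤-trans m≤3 3≤∣W∣) (λ _ → 0F) =
    ¬distinguishing c off-W dist

  ¬monochromatic : ¬ Σ (Coloring n 1) Distinguishing
  ¬monochromatic (c , dist) = far (+ 1) (+ 0) (residue-injective {+ 1} {+ 0} (dist (rot 1F) (λ _ → only _ _) 0F))
    where
    only : ∀ (i j : Fin 1) → i ≡ j
    only 0F 0F = refl

-- Arithmetic of the number of vertices

-- A prime not dividing `n` is coprime to it, so Euclid's lemma cancels it.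
prime-cancellable : ∀ {n p} → Prime p → ¬ p ∣ n → Congruence.Cancellable n (+ p)
prime-cancellable {n} {p} pr p∤n .Congruence.Cancellable.cancel i n∣pi =
  ∣ᵤ⇒∣ (coprime-divisor (+ n) (+ p) i coprime (∣⇒∣ᵤ n∣pi))
  where
  coprime : ∀ {d} → d ∣ n × d ∣ p → d ≡ 1
  coprime (d∣n , d∣p) with prime⇒irreducible pr d∣p
  ... | inj₁ d≡1  = d≡1
  ... | inj₂ refl = ⊥-elim (p∤n d∣n)

odd-half : ∀ {n} → ¬ 2 ∣ n → ∀ a → ∃ λ x → Congruence._≈_ n (x + x) a
odd-half {n} 2∤n a with n % 2 in r≡ | m%n<n n 2 | m≡m%n+[m/n]*n n 2
... | 0 | _ | n≡ = ⊥-elim (2∤n (m%n≡0⇒n∣m n 2 r≡))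
-- For n = 2q + 1 the inverse of 2 modulo `n` is 1 + q.
... | 1 | _ | n≡ = a * + ℕ.suc (n / 2) , Congruence.congruent (divides a (begin
    a * (1ℤ + q) + a * (1ℤ + q) - a      ≡⟨ regroup a q ⟩
    a * (1ℤ + q * + 2)                   ≡⟨ cong (λ m → a * (1ℤ + m)) (ℤₚ.pos-* (n / 2) 2) ⟨
    a * + (1 ℕ.+ (n / 2) ℕ.* 2)          ≡⟨ cong (λ m → a * + m) n≡ ⟨
    a * + n                              ∎))
  where
  open ≡-Reasoning
  q = + (n / 2)
  regroup : ∀ a q → a * (1ℤ + q) + a * (1ℤ + q) - a ≡ a * (1ℤ + q * + 2)
  regroup = solve-∀
... | ℕ.suc (ℕ.suc _) | s≤s (s≤s ()) | _

coprime-to-30⇒7≤n : ∀ n → 3 ≤ n → ¬ 2 ∣ n → ¬ 3 ∣ n → ¬ 5 ∣ n → 7 ≤ n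
coprime-to-30⇒7≤n 0 () _ _ _
coprime-to-30⇒7≤n 1 (s≤s ()) _ _ _
coprime-to-30⇒7≤n 2 (s≤s (s≤s ())) _ _ _
coprime-to-30⇒7≤n 3 _ _ 3∤n _ = ⊥-elim (3∤n (dividesℕ 1 refl))
coprime-to-30⇒7≤n 4 _ 2∤n _ _ = ⊥-elim (2∤n (dividesℕ 2 refl))
coprime-to-30⇒7≤n 5 _ _ _ 5∤n = ⊥-elim (5∤n (dividesℕ 1 refl))
coprime-to-30⇒7≤n 6 _ 2∤n _ _ = ⊥-elim (2∤n (dividesℕ 3 refl))
coprime-to-30⇒7≤n (ℕ.suc (ℕ.suc (ℕ.suc (ℕ.suc (ℕ.suc (ℕ.suc (ℕ.suc n))))))) _ _ _ _ =
  s≤s (s≤s (s≤s (s≤s (s≤s (s≤s (s≤s z≤n))))))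

theorem6 : ∀ (n : ℕ) .{{_ : NonZero n}} → 3 ≤ n →
    (∀ (p : ℕ) → Prime p → p ∣ n → 7 ≤ p) →
    ∀ (d : ℕ) → IsDistNumber n d → IsExtD n d 4
theorem6 1 (s≤s ())
theorem6 2 (s≤s (s≤s ()))
theorem6 n@(ℕ.suc (ℕ.suc (ℕ.suc k))) 3≤n 7≤p = go
  where
  ∤ : ∀ {p} → Prime p → p < 7 → ¬ p ∣ n
  ∤ {p} pr p<7 p∣n = ℕₚ.<⇒≱ p<7 (7≤p p pr p∣n)
  2∤n : ¬ 2 ∣ n
  2∤n = ∤ (from-yes (prime? 2)) (from-yes (2 ℕ.<? 7))
  3∤n : ¬ 3 ∣ n
  3∤n = ∤ (from-yes (prime? 3)) (from-yes (3 ℕ.<? 7))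
  5∤n : ¬ 5 ∣ n
  5∤n = ∤ (from-yes (prime? 5)) (from-yes (5 ℕ.<? 7))
  7≤n : 7 ≤ n
  7≤n = coprime-to-30⇒7≤n n 3≤n 2∤n 3∤n 5∤n
  open LowerBound k 7≤n using (¬ext; ¬monochromatic)
  open Extension n (prime-cancellable (from-yes (prime? 2)) 2∤n) (prime-cancellable (from-yes (prime? 3)) 3∤n)
    (prime-cancellable (from-yes (prime? 5)) 5∤n) (odd-half 2∤n) using (extension)
  4≤∣⊤∣ : 4 ≤ Subset.∣ Subset.⊤ {n} ∣
  4≤∣⊤∣ = subst (4 ≤_) (sym (∣⊤∣≡n n)) (ℕₚ.≤-trans (from-yes (4 ≤? 7)) 7≤n)
  -- The distinguishing number has to be 2: no colours cannot colour a vertex, one colour is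
  -- preserved by a rotation, and extending from W = `⊤` produces a distinguishing 2-colouring, so
  -- no larger `d` is minimal.
  go : ∀ d → IsDistNumber n d → IsExtD n d 4
  go 0 ((c , _) , _) with () ← c 0F
  go 1 (mono , _) = ⊥-elim (¬monochromatic mono)
  go 2 _ = (λ W _ → extension W) , ¬ext
  go (ℕ.suc (ℕ.suc (ℕ.suc d))) (_ , minimal) =
    ⊥-elim (minimal 2 (s≤s (s≤s (s≤s z≤n))) (map₂ proj₁ (extension Subset.⊤ 4≤∣⊤∣ (λ _ → 0F))))
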